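{- For a positive integer $t$, let $f(n;t)$ denote the maximum number of edges in a linear $3$-uniform hypergraph on $n$ vertices which contains no $2$-regular subhypergraph with at most $t$ edges. For any integer $\ell\geq 2$ there exists a constant $c=c(\ell)$ such that for all $n$, $$f(n;4\ell)\leq c\, n^{3/2+1/\ell}.$$
   Context: A hypergraph is linear if any two distinct edges intersect in at most one vertex. A non-empty hypergraph is $2$-regular if every vertex in it has degree $2$; a subhypergraph is given by a subset of the edges together with the vertices they cover. -}

module Defs where

open import Data.Nat using (ℕ; _≤_)
open import Data.Fin using (Fin)
open import Data.Fin.Subset using (Subset; ∣_∣; _∩_; Nonempty)
open import Data.Vec using (lookup; tabulate)
open import Data.Product using (Σ; _×_)
open import Data.Sum using (_⊎_)
open import Data.Empty using (⊥)
open import Relation.Binary.PropositionalEquality using (_≡_; _≢_)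
open import Function.Definitions using (Injective)

record Hypergraph3 (n m : ℕ) : Set where
  field
    edge     : Fin m → Subset n
    distinct : Injective _≡_ _≡_ edge
    uniform  : ∀ i → ∣ edge i ∣ ≡ 3

open Hypergraph3 public

Linear : ∀ {n m} → Hypergraph3 n m → Set
Linear {m = m} H = ∀ (i j : Fin m) → i ≢ j → ∣ edge H i ∩ edge H j ∣ ≤ 1

degIn : ∀ {n m} → Hypergraph3 n m → Subset m → Fin n → ℕ
degIn H S v = ∣ S ∩ tabulate (λ i → lookup (edge H i) v) ∣

-- S (a subset of the edges) spans a 2-regular subhypergraph: non-empty,
-- and every vertex covered by S has degree exactly 2 in S
-- (uncovered vertices have degree 0 and are not vertices of the subhypergraph).
TwoRegularSub : ∀ {n m} → Hypergraph3 n m → Subset m → Set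
TwoRegularSub {n} H S = Nonempty S × (∀ (v : Fin n) → degIn H S v ≡ 0 ⊎ degIn H S v ≡ 2)

No2RegUpTo : ∀ {n m} → ℕ → Hypergraph3 n m → Set
No2RegUpTo {m = m} t H = ∀ (S : Subset m) → TwoRegularSub H S → ∣ S ∣ ≤ t → ⊥

{-# OPTIONS --safe #-}

-- Consider the auxiliary graph on pairs of vertices in which (a , a′) is adjacent to (b , b′) when
-- {a,b,z} and {a′,b′,z} are distinct edges for some z; it has M ≳ m²/n directed edges ("darts").
-- A closed walk of length 2k all of whose vertices and apices z are distinct uses 4k edges of the
-- hypergraph and spans a 2-regular subhypergraph, so every closed walk of length 2k ≤ 2ℓ contains two
-- conflicting darts. Rotate it so that one of them comes first and the other lies among the last k darts.
-- By linearity only boundedly many darts from a given vertex conflict with a given dart, and comparing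
-- the numbers of walks along the two arcs shows that the number S k of closed walks of length 2k is at
-- most C δ S (k-1), where δ bounds all degrees. Hence S ℓ ≤ (C δ)^ℓ N, whereas Cauchy–Schwarz gives
-- S ℓ ≥ (M/N)^(2ℓ). To have δ ≈ M/n² and N ≈ n², the vertices of the auxiliary graph are first split
-- into classes of out-degree at most δ; conflicts are defined on darts and survive the splitting.
module Submission where

open import Defs
open import Data.Nat using (ℕ; zero; suc; _+_; _*_; _^_; _/_; _≤_; _<_; z≤n; s≤s; NonZero; >-nonZero; >-nonZero⁻¹)
import Data.Nat as ℕ
open import Data.Nat.Properties hiding (_≟_)
open import Data.Nat.DivMod using (m≡m%n+[m/n]*n; m%n<n; m/n*n≤m; /-monoˡ-≤; m<n⇒m%n≡m; _mod_)
open import Data.Nat.Solver using (module +-*-Solver)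
open import Data.Bool using (if_then_else_)
open import Data.Empty using (⊥; ⊥-elim)
open import Data.Fin as Fin using (Fin; zero; suc; toℕ; fromℕ; inject₁)
import Data.Fin.Properties as Fin
open import Data.Fin.Relation.Unary.Top using (view; ‵fromℕ; ‵inject₁)
open import Data.Fin.Subset using (Subset; inside; outside; ∣_∣; _∩_; _∪_; ⁅_⁆)
  renaming (_∈_ to _∈ˢ_; ⊥ to ∅)
open import Data.Fin.Subset.Properties
  using (_∈?_; x∈p⇒∣p-x∣<∣p∣; x∈p∧x≢y⇒x∈p-y; x∈p∩q⁺; x∈p∩q⁻; x∈p∪q⁺; x∈p∪q⁻; x∈⁅x⁆; x∈⁅y⁆⇒x≡y; ∣⁅x⁆∣≡1; ∣⊥∣≡0; ∉⊥; p⊆q⇒∣p∣≤∣q∣; ∣p∣≤∣x∷p∣)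
open import Data.List using (List; []; _∷_; _++_; length; map; filter; drop; concatMap; upTo; downFrom; allFin; cartesianProduct; lookup)
open import Data.List.Properties using (++-assoc; ++-identityʳ; length-++; length-map; length-tabulate; length-upTo; length-downFrom)
open import Data.List.Membership.Propositional using (_∈_)
open import Data.List.Membership.Propositional.Properties
  using (∈-++⁺ʳ; ∈-lookup; ∈-allFin; ∈-upTo⁺; ∈-downFrom⁺; ∈-cartesianProduct⁺; ∈-cartesianProduct⁻; ∈-filter⁺; ∈-filter⁻)
open import Data.List.Relation.Unary.All as All using (All; []; _∷_)
import Data.List.Relation.Unary.All.Properties as All
open import Data.List.Relation.Unary.AllPairs using (AllPairs; []; _∷_)
open import Data.List.Relation.Unary.Any using (here; there)
open import Data.List.Relation.Unary.Unique.Propositional using (Unique)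
open import Data.List.Relation.Unary.Unique.Propositional.Properties
  using (allFin⁺; downFrom⁺; cartesianProduct⁺; filter⁺; map⁺)
open import Data.Product using (Σ; _×_; _,_; proj₁; proj₂; ∃-syntax)
open import Data.Product.Properties using (≡-dec)
open import Data.Sum using (_⊎_; inj₁; inj₂; [_,_]′)
open import Data.Vec using ([]; _∷_; here; there; tabulate)
import Data.Vec as Vec
open import Data.Vec.Properties using (lookup⇒[]=; []=⇒lookup; lookup∘tabulate)
open import Function using (_∘_)
open import Level using (0ℓ)
open import Relation.Binary using (DecidableEquality)
open import Relation.Binary.PropositionalEquality
open import Relation.Nullary using (Dec; yes; no; does; contradiction; ¬_)
open import Relation.Nullary.Decidable using (_×-dec_; _⊎-dec_; ¬?; map′)
open import Relation.Unary using (Pred; Decidable)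

open +-*-Solver using (solve; _:+_; _:*_; con; _:=_)

-- The recursion for closed walks loses the maximal degree in every step, while the Cauchy-Schwarz
-- lower bound sees only the average degree, and the auxiliary graph may be very irregular.
-- Splitting makes the two comparable; it destroys walks, but the lower bound depends only on the
-- numbers of darts and of classes. The recursion gains from a conflict as follows. A rotated closed
-- walk consists of a first dart, an arc of k darts and an arc of k+1 darts, and the first dart
-- conflicts with the longer arc. A weighted AM-GM splits the product of the two arc counts into
-- squares. In the square of the short arc, the sum over the first dart costs a factor δ and leaves
-- `S k`. In the square of the long arc it costs only a constant, as few first darts conflict with a
-- given arc; that square gives `S (k+1)` with a coefficient small enough to be absorbed. The
-- exponent: (M/N)^(2ℓ) ≤ (Cδ)^ℓ N with δ ≈ M/n² and N ≈ n² gives M ≲ n^(2+2/ℓ), and m² ≲ nM turns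
-- this into m ≲ n^(3/2+1/ℓ). All inequalities are kept free of division, in natural numbers.

private variable
  A B : Set
  k : ℕ

-- Finite sums over lists and the Cauchy-Schwarz inequality

∑ : List A → (A → ℕ) → ℕ
∑ []       f = 0
∑ (x ∷ xs) f = f x + ∑ xs f

infix 5 ∑
syntax ∑ xs (λ x → e) = ∑[ x ← xs ] e

⟦_⟧ : {P : Set} → Dec P → ℕ
⟦ d ⟧ = if does d then 1 else 0

⟦⟧≤1 : {P : Set} (d : Dec P) → ⟦ d ⟧ ≤ 1
⟦⟧≤1 (yes _) = ≤-refl
⟦⟧≤1 (no _)  = z≤n

⟦⟧-yes : {P : Set} (d : Dec P) → P → ⟦ d ⟧ ≡ 1
⟦⟧-yes (yes _) p = refl
⟦⟧-yes (no ¬p) p = contradiction p ¬p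

⟦⟧-no : {P : Set} (d : Dec P) → (P → 1 ≤ 0) → ⟦ d ⟧ ≡ 0
⟦⟧-no (yes p) ¬p = contradiction (¬p p) λ ()
⟦⟧-no (no _)  ¬p = refl

⟦⟧-pos : {P : Set} (d : Dec P) → 1 ≤ ⟦ d ⟧ → P
⟦⟧-pos (yes p) _ = p

⟦⟧-≤ : {P : Set} (d : Dec P) {k : ℕ} → (P → 1 ≤ k) → ⟦ d ⟧ ≤ k
⟦⟧-≤ (yes p) h = h p
⟦⟧-≤ (no _)  h = z≤n

⟦⟧-mono : {P Q : Set} (d : Dec P) (d′ : Dec Q) → (P → Q) → ⟦ d ⟧ ≤ ⟦ d′ ⟧
⟦⟧-mono d d′ f = ⟦⟧-≤ d (λ p → ≤-reflexive (sym (⟦⟧-yes d′ (f p))))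

⟦⟧-cong : {P Q : Set} (d : Dec P) (d′ : Dec Q) → (P → Q) → (Q → P) → ⟦ d ⟧ ≡ ⟦ d′ ⟧
⟦⟧-cong d d′ f g = ≤-antisym (⟦⟧-mono d d′ f) (⟦⟧-mono d′ d g)

∑-cong : ∀ (xs : List A) {f g} → (∀ x → f x ≡ g x) → ∑ xs f ≡ ∑ xs g
∑-cong []       h = refl
∑-cong (x ∷ xs) h = cong₂ _+_ (h x) (∑-cong xs h)

∑-mono : ∀ (xs : List A) {f g} → (∀ {x} → x ∈ xs → f x ≤ g x) → ∑ xs f ≤ ∑ xs g
∑-mono []       h = z≤n
∑-mono (x ∷ xs) h = +-mono-≤ (h (here refl)) (∑-mono xs (λ x∈ → h (there x∈)))

∑-cong-∈ : ∀ (xs : List A) {f g} → (∀ {x} → x ∈ xs → f x ≡ g x) → ∑ xs f ≡ ∑ xs g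
∑-cong-∈ []       h = refl
∑-cong-∈ (x ∷ xs) h = cong₂ _+_ (h (here refl)) (∑-cong-∈ xs (λ x∈ → h (there x∈)))

∑-+ : ∀ (xs : List A) f g → (∑[ x ← xs ] (f x + g x)) ≡ ∑ xs f + ∑ xs g
∑-+ []       f g = refl
∑-+ (x ∷ xs) f g = trans (cong (f x + g x +_) (∑-+ xs f g))
  (solve 4 (λ a b c d → (a :+ b) :+ (c :+ d) := (a :+ c) :+ (b :+ d)) refl (f x) (g x) (∑ xs f) (∑ xs g))

∑-*ˡ : ∀ (xs : List A) c f → (∑[ x ← xs ] c * f x) ≡ c * ∑ xs f
∑-*ˡ []       c f = sym (*-zeroʳ c)
∑-*ˡ (x ∷ xs) c f = trans (cong (c * f x +_) (∑-*ˡ xs c f)) (sym (*-distribˡ-+ c (f x) (∑ xs f)))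

∑-*ʳ : ∀ (xs : List A) f c → (∑[ x ← xs ] f x * c) ≡ ∑ xs f * c
∑-*ʳ xs f c = trans (∑-cong xs (λ x → *-comm (f x) c)) (trans (∑-*ˡ xs c f) (*-comm c (∑ xs f)))

∑-const : ∀ (xs : List A) c → (∑[ _ ← xs ] c) ≡ length xs * c
∑-const []       c = refl
∑-const (x ∷ xs) c = cong (c +_) (∑-const xs c)

∑-zero : ∀ (xs : List A) → (∑[ _ ← xs ] 0) ≡ 0
∑-zero xs = trans (∑-const xs 0) (*-zeroʳ (length xs))

∑-swap : ∀ (xs : List A) (ys : List B) (f : A → B → ℕ) →
         (∑[ x ← xs ] ∑[ y ← ys ] f x y) ≡ (∑[ y ← ys ] ∑[ x ← xs ] f x y)
∑-swap []       ys f = sym (∑-zero ys)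
∑-swap (x ∷ xs) ys f = trans (cong (∑ ys (f x) +_) (∑-swap xs ys f))
                             (sym (∑-+ ys (f x) (λ y → ∑ xs (λ x → f x y))))

∑-* : ∀ (xs : List A) (ys : List B) f g → ∑ xs f * ∑ ys g ≡ (∑[ x ← xs ] ∑[ y ← ys ] f x * g y)
∑-* xs ys f g = trans (sym (∑-*ʳ xs f (∑ ys g))) (∑-cong xs (λ x → sym (∑-*ˡ ys (f x) g)))

∑-++ : ∀ (xs ys : List A) f → ∑ (xs ++ ys) f ≡ ∑ xs f + ∑ ys f
∑-++ []       ys f = refl
∑-++ (x ∷ xs) ys f = trans (cong (f x +_) (∑-++ xs ys f)) (sym (+-assoc (f x) _ _))

∑-map : ∀ (h : A → B) (xs : List A) f → ∑ (map h xs) f ≡ ∑ xs (λ x → f (h x))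
∑-map h []       f = refl
∑-map h (x ∷ xs) f = cong (f (h x) +_) (∑-map h xs f)

∑-filter : ∀ {P : Pred A 0ℓ} (P? : Decidable P) (xs : List A) f →
           ∑ (filter P? xs) f ≡ (∑[ x ← xs ] ⟦ P? x ⟧ * f x)
∑-filter P? []       f = refl
∑-filter P? (x ∷ xs) f with P? x
... | yes _ = cong₂ _+_ (sym (+-identityʳ (f x))) (∑-filter P? xs f)
... | no  _ = ∑-filter P? xs f

∑-∈ : ∀ {xs : List A} {x} f → x ∈ xs → f x ≤ ∑ xs f
∑-∈ f (here refl) = m≤m+n (f _) _
∑-∈ f (there x∈)  = ≤-trans (∑-∈ f x∈) (m≤n+m _ _)

-- Truncated subtraction is avoided: the larger number is the smaller one plus `d`, and the two
-- sides differ by `d * d`.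
amgm : ∀ a b → 2 * (a * b) ≤ a * a + b * b
amgm a b with ≤-total a b
... | inj₁ a≤b with m≤n⇒∃[o]m+o≡n a≤b
...   | d , refl = ≤-trans (m≤m+n _ (d * d)) (≤-reflexive
        (solve 2 (λ a d → con 2 :* (a :* (a :+ d)) :+ d :* d := a :* a :+ (a :+ d) :* (a :+ d)) refl a d))
amgm a b | inj₂ b≤a with m≤n⇒∃[o]m+o≡n b≤a
...   | d , refl = ≤-trans (m≤m+n _ (d * d)) (≤-reflexive
        (solve 2 (λ b d → con 2 :* ((b :+ d) :* b) :+ d :* d := (b :+ d) :* (b :+ d) :+ b :* b) refl b d))

-- Twice the square of the mixed sum is a double sum over pairs (x, y); `amgm` is applied to
-- `f x * g y` and `f y * g x` in each term.
cauchy : ∀ (xs : List A) (f g : A → ℕ) →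
  (∑[ x ← xs ] f x * g x) * (∑[ x ← xs ] f x * g x) ≤ (∑[ x ← xs ] f x * f x) * (∑[ x ← xs ] g x * g x)
cauchy xs f g = *-cancelˡ-≤ 2 (begin
  2 * (fg * fg)
    ≡⟨ cong (2 *_) (∑-* xs xs _ _) ⟩
  2 * (∑[ x ← xs ] ∑[ y ← xs ] f x * g x * (f y * g y))
    ≡⟨ trans (sym (∑-*ˡ xs 2 _)) (∑-cong xs (λ x → sym (∑-*ˡ xs 2 _))) ⟩
  (∑[ x ← xs ] ∑[ y ← xs ] 2 * (f x * g x * (f y * g y)))
    ≤⟨ ∑-mono xs (λ {x} _ → ∑-mono xs (λ {y} _ → cross x y)) ⟩
  (∑[ x ← xs ] ∑[ y ← xs ] (f x * f x * (g y * g y) + f y * f y * (g x * g x)))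
    ≡⟨ trans (∑-cong xs (λ x → ∑-+ xs _ _)) (∑-+ xs _ _) ⟩
  (∑[ x ← xs ] ∑[ y ← xs ] f x * f x * (g y * g y)) + (∑[ x ← xs ] ∑[ y ← xs ] f y * f y * (g x * g x))
    ≡⟨ cong₂ _+_ (sym (∑-* xs xs _ _)) (trans (∑-swap xs xs _) (sym (∑-* xs xs _ _))) ⟩
  ff * gg + ff * gg
    ≡⟨ cong (ff * gg +_) (sym (+-identityʳ (ff * gg))) ⟩
  2 * (ff * gg) ∎)
  where
  open ≤-Reasoning
  fg = ∑[ x ← xs ] f x * g x
  ff = ∑[ x ← xs ] f x * f x
  gg = ∑[ x ← xs ] g x * g x
  cross : ∀ x y → 2 * (f x * g x * (f y * g y)) ≤ f x * f x * (g y * g y) + f y * f y * (g x * g x)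
  cross x y = subst₂ _≤_
    (solve 4 (λ a b c d → con 2 :* ((a :* d) :* (c :* b)) := con 2 :* ((a :* b) :* (c :* d))) refl (f x) (g x) (f y) (g y))
    (solve 4 (λ a b c d → (a :* d) :* (a :* d) :+ (c :* b) :* (c :* b)
                       := (a :* a) :* (d :* d) :+ (c :* c) :* (b :* b)) refl (f x) (g x) (f y) (g y))
    (amgm (f x * g y) (f y * g x))

cauchy-1 : ∀ (xs : List A) f → ∑ xs f * ∑ xs f ≤ length xs * (∑[ x ← xs ] f x * f x)
cauchy-1 xs f = begin
  ∑ xs f * ∑ xs f
    ≡⟨ cong₂ _*_ eq eq ⟩
  (∑[ x ← xs ] 1 * f x) * (∑[ x ← xs ] 1 * f x)
    ≤⟨ cauchy xs (λ _ → 1) f ⟩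
  (∑[ x ← xs ] 1) * (∑[ x ← xs ] f x * f x)
    ≡⟨ cong (_* (∑[ x ← xs ] f x * f x)) (trans (∑-const xs 1) (*-identityʳ (length xs))) ⟩
  length xs * (∑[ x ← xs ] f x * f x) ∎
  where
  open ≤-Reasoning
  eq : ∑ xs f ≡ (∑[ x ← xs ] 1 * f x)
  eq = ∑-cong xs (λ x → sym (+-identityʳ (f x)))

-- Sums over tuples, rotations, and the search for a conflicting pair

∑ⁿ : List A → ℕ → (List A → ℕ) → ℕ
∑ⁿ xs zero    F = F []
∑ⁿ xs (suc n) F = ∑[ x ← xs ] ∑ⁿ xs n (λ v → F (x ∷ v))

module _ (xs : List A) where

  ∑ⁿ-cong : ∀ n {F G : List A → ℕ} → (∀ v → length v ≡ n → F v ≡ G v) → ∑ⁿ xs n F ≡ ∑ⁿ xs n G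
  ∑ⁿ-cong zero    h = h [] refl
  ∑ⁿ-cong (suc n) h = ∑-cong xs (λ x → ∑ⁿ-cong n (λ v eq → h (x ∷ v) (cong suc eq)))

  ∑ⁿ-mono : ∀ n {F G : List A → ℕ} → (∀ v → length v ≡ n → All (_∈ xs) v → F v ≤ G v) → ∑ⁿ xs n F ≤ ∑ⁿ xs n G
  ∑ⁿ-mono zero    h = h [] refl []
  ∑ⁿ-mono (suc n) h = ∑-mono xs (λ {x} x∈ → ∑ⁿ-mono n (λ v eq v∈ → h (x ∷ v) (cong suc eq) (x∈ ∷ v∈)))

  ∑ⁿ-*ˡ : ∀ n c F → ∑ⁿ xs n (λ v → c * F v) ≡ c * ∑ⁿ xs n F
  ∑ⁿ-*ˡ zero    c F = refl
  ∑ⁿ-*ˡ (suc n) c F = trans (∑-cong xs (λ x → ∑ⁿ-*ˡ n c (λ v → F (x ∷ v)))) (∑-*ˡ xs c _)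

  ∑ⁿ-*ʳ : ∀ n F c → ∑ⁿ xs n (λ v → F v * c) ≡ ∑ⁿ xs n F * c
  ∑ⁿ-*ʳ zero    F c = refl
  ∑ⁿ-*ʳ (suc n) F c = trans (∑-cong xs (λ x → ∑ⁿ-*ʳ n (λ v → F (x ∷ v)) c)) (∑-*ʳ xs _ c)

  ∑ⁿ-∑ : ∀ {B : Set} n (ys : List B) (F : List A → B → ℕ) →
         ∑ⁿ xs n (λ v → ∑[ y ← ys ] F v y) ≡ (∑[ y ← ys ] ∑ⁿ xs n (λ v → F v y))
  ∑ⁿ-∑ zero    ys F = refl
  ∑ⁿ-∑ (suc n) ys F = trans (∑-cong xs (λ x → ∑ⁿ-∑ n ys (λ v → F (x ∷ v)))) (∑-swap xs ys _)

  ∑ⁿ-++ : ∀ m n F → ∑ⁿ xs (m + n) F ≡ ∑ⁿ xs m (λ u → ∑ⁿ xs n (λ v → F (u ++ v)))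
  ∑ⁿ-++ zero    n F = refl
  ∑ⁿ-++ (suc m) n F = ∑-cong xs (λ x → ∑ⁿ-++ m n (λ v → F (x ∷ v)))

rot : List A → List A
rot []       = []
rot (x ∷ xs) = xs ++ x ∷ []

rot^ : ℕ → List A → List A
rot^ zero    v = v
rot^ (suc a) v = rot^ a (rot v)

-- Rotation only moves the outermost sum to the innermost place.
∑ⁿ-rot : ∀ (xs : List A) n F → ∑ⁿ xs n (λ v → F (rot v)) ≡ ∑ⁿ xs n F
∑ⁿ-rot xs zero    F = refl
∑ⁿ-rot xs (suc n) F = begin
  (∑[ x ← xs ] ∑ⁿ xs n (λ v → F (v ++ x ∷ [])))
    ≡⟨ sym (∑ⁿ-∑ xs n xs (λ v x → F (v ++ x ∷ []))) ⟩
  ∑ⁿ xs n (λ v → ∑ⁿ xs 1 (λ u → F (v ++ u)))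
    ≡⟨ sym (∑ⁿ-++ xs n 1 F) ⟩
  ∑ⁿ xs (n + 1) F
    ≡⟨ cong (λ k → ∑ⁿ xs k F) (+-comm n 1) ⟩
  ∑ⁿ xs (suc n) F ∎
  where open ≡-Reasoning

rot^-++ : ∀ (u v : List A) → rot^ (length u) (u ++ v) ≡ v ++ u
rot^-++ []      v = sym (++-identityʳ v)
rot^-++ (x ∷ u) v = trans (cong (rot^ (length u)) (++-assoc u v (x ∷ [])))
  (trans (rot^-++ u (v ++ x ∷ [])) (++-assoc v (x ∷ []) u))

∈-drop : ∀ k (u : List A) {f v} → k ≤ length u → f ∈ drop k (u ++ f ∷ v)
∈-drop zero    u       _         = ∈-++⁺ʳ u (here refl)
∈-drop (suc k) (x ∷ u) (s≤s k≤u) = ∈-drop k u k≤u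

drop-++ˡ : ∀ (u v : List A) → drop (length u) (u ++ v) ≡ v
drop-++ˡ []      v = refl
drop-++ˡ (x ∷ u) v = drop-++ˡ u v

-- The hypothesis is a mere negation, so the pair has to be found by search: each entry is compared
-- with all later ones.
split-conflict : ∀ (χ : A → A → ℕ) v → (AllPairs (λ e f → χ e f ≡ 0) v → ⊥) →
  ∃[ X ] ∃[ e ] ∃[ Y ] ∃[ f ] ∃[ Z ] (v ≡ X ++ e ∷ Y ++ f ∷ Z × 1 ≤ χ e f)
split-conflict {A} χ []      bad = ⊥-elim (bad [])
split-conflict {A} χ (e ∷ v) bad with scan v
  where
  scan : ∀ u → All (λ f → χ e f ≡ 0) u ⊎ ∃[ Y ] ∃[ f ] ∃[ Z ] (u ≡ Y ++ f ∷ Z × 1 ≤ χ e f)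
  scan []      = inj₁ []
  scan (f ∷ u) with χ e f in eq | scan u
  ... | suc _ | _ = inj₂ ([] , f , u , refl , subst (1 ≤_) (sym eq) (s≤s z≤n))
  ... | zero  | inj₁ none = inj₁ (eq ∷ none)
  ... | zero  | inj₂ (Y , g , Z , u≡ , pos) = inj₂ (f ∷ Y , g , Z , cong (f ∷_) u≡ , pos)
... | inj₂ (Y , f , Z , v≡ , pos) = [] , e , Y , f , Z , cong (e ∷_) v≡ , pos
... | inj₁ none with split-conflict χ v (λ ps → bad (none ∷ ps))
...   | X , e′ , Y , f , Z , v≡ , pos = e ∷ X , e′ , Y , f , Z , cong (e ∷_) v≡ , pos

module Rotation (χ : A → A → ℕ) (χ-sym : ∀ e f → χ e f ≡ χ f e) where

  -- On a list of length 2(k+1), `drop k` leaves exactly the last k+1 entries. The conflicts of the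
  -- first entry with these are counted, so that an arc of k entries stays free of any condition.
  g : ℕ → List A → ℕ
  g k []      = 0
  g k (e ∷ v) = ∑[ f ← drop k v ] χ e f

  g-pos : ∀ k e u f v → k ≤ length u → 1 ≤ χ e f → 1 ≤ g k (e ∷ u ++ f ∷ v)
  g-pos k e u f v k≤ pos = ≤-trans pos (∑-∈ (χ e) (∈-drop k u k≤))

  -- Of the two arcs between the conflicting positions, one has at least k interior points.
  cover : ∀ k v → length v ≡ suc k + suc k → (AllPairs (λ e f → χ e f ≡ 0) v → ⊥) →
          1 ≤ (∑[ a ← upTo (suc k + suc k) ] g k (rot^ a v))
  cover k v len bad with split-conflict χ v bad
  ... | X , e , Y , f , Z , refl , pos with ≤-<-connex k (length Y)
  ...   | inj₁ k≤Y = ≤-trans (subst (λ u → 1 ≤ g k u) (sym rotated) (g-pos k e Y f (Z ++ X) k≤Y pos))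
                             (∑-∈ _ (∈-upTo⁺ X<))
    where
    rotated : rot^ (length X) (X ++ e ∷ Y ++ f ∷ Z) ≡ e ∷ Y ++ f ∷ (Z ++ X)
    rotated = trans (rot^-++ X (e ∷ Y ++ f ∷ Z)) (cong (e ∷_) (++-assoc Y (f ∷ Z) X))
    X< : length X < suc k + suc k
    X< = subst (length X <_) (trans (sym (length-++ X)) len)
           (m<m+n (length X) (s≤s z≤n))
  ...   | inj₂ Y<k = ≤-trans (subst (λ u → 1 ≤ g k u) (sym rotated)
                                (g-pos k f (Z ++ X) e Y k≤ZX (subst (1 ≤_) (χ-sym e f) pos)))
                             (∑-∈ _ (∈-upTo⁺ W<))
    where
    W : List A
    W = X ++ e ∷ Y
    v≡ : X ++ e ∷ Y ++ f ∷ Z ≡ W ++ f ∷ Z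
    v≡ = sym (++-assoc X (e ∷ Y) (f ∷ Z))
    rotated : rot^ (length W) (X ++ e ∷ Y ++ f ∷ Z) ≡ f ∷ (Z ++ X) ++ e ∷ Y
    rotated = trans (cong (rot^ (length W)) v≡)
      (trans (rot^-++ W (f ∷ Z)) (cong (f ∷_) (sym (++-assoc Z X (e ∷ Y)))))
    W< : length W < suc k + suc k
    W< = subst (length W <_) (trans (sym (length-++ W)) (trans (cong length (sym v≡)) len))
           (m<m+n (length W) (s≤s z≤n))
    lens : length X + suc (length Y + suc (length Z)) ≡ suc k + suc k
    lens = trans (cong (λ n → length X + suc n) (sym (length-++ Y))) (trans (sym (length-++ X)) len)
    total : (length Z + length X) + length Y ≡ k + k
    total = +-cancelˡ-≡ 2 _ _ (trans
      (solve 3 (λ x y z → con 2 :+ ((z :+ x) :+ y) := x :+ (con 1 :+ (y :+ (con 1 :+ z)))) refl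
        (length X) (length Y) (length Z))
      (trans lens (solve 1 (λ k → con 1 :+ k :+ (con 1 :+ k) := con 2 :+ (k :+ k)) refl k)))
    k≤ZX : k ≤ length (Z ++ X)
    k≤ZX = subst (k ≤_) (sym (length-++ Z)) (+-cancelʳ-≤ (length Y) k _
             (≤-trans (+-monoʳ-≤ k (<⇒≤ Y<k)) (≤-reflexive (sym total))))

-- Cyclic, so that the closing condition of a walk is the case `zero` of the condition linking
-- consecutive darts.
prev : Fin (suc k) → Fin (suc k)
prev {k} zero    = fromℕ k
prev     (suc i) = inject₁ i

prev-injective : ∀ {i j : Fin (suc k)} → prev i ≡ prev j → i ≡ j
prev-injective {i = zero}  {zero}  _  = refl
prev-injective {i = zero}  {suc j} eq = contradiction eq Fin.fromℕ≢inject₁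
prev-injective {i = suc i} {zero}  eq = contradiction (sym eq) Fin.fromℕ≢inject₁
prev-injective {i = suc i} {suc j} eq = cong suc (Fin.inject₁-injective eq)

prev-surjective : ∀ (j : Fin (suc k)) → ∃[ i ] prev i ≡ j
prev-surjective j with view j
... | ‵fromℕ     = zero , refl
... | ‵inject₁ i = suc i , refl

-- Walk counting in a finite symmetric multigraph

module Walks {E V : Set} (𝔼 : List E) (𝕍 : List V) (_≟_ : DecidableEquality V) (s t : E → V)
  -- `∑-δ` encodes that every vertex occurs exactly once in `𝕍`; `reversible` is the symmetry of the
  -- adjacency matrix.
  (∑-δ : ∀ c (F : V → ℕ) → (∑[ x ← 𝕍 ] ⟦ c ≟ x ⟧ * F x) ≡ F c)
  (reversible : ∀ x y → (∑[ e ← 𝔼 ] ⟦ s e ≟ x ⟧ * ⟦ t e ≟ y ⟧) ≡ (∑[ e ← 𝔼 ] ⟦ s e ≟ y ⟧ * ⟦ t e ≟ x ⟧))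
  where

  p : ℕ → V → V → ℕ
  p zero    x y = ⟦ x ≟ y ⟧
  p (suc k) x y = ∑[ e ← 𝔼 ] ⟦ s e ≟ x ⟧ * p k (t e) y

  -- The indicator that a list of edges is a walk from `x` to `y`. As a product of brackets it can
  -- be cut at an intermediate vertex by a sum.
  wk : V → List E → V → ℕ
  wk x []      y = ⟦ x ≟ y ⟧
  wk x (e ∷ v) y = ⟦ s e ≟ x ⟧ * wk (t e) v y

  ∑ⁿ-wk : ∀ k x y → ∑ⁿ 𝔼 k (λ v → wk x v y) ≡ p k x y
  ∑ⁿ-wk zero    x y = refl
  ∑ⁿ-wk (suc k) x y = ∑-cong 𝔼 (λ e → trans (∑ⁿ-*ˡ 𝔼 k ⟦ s e ≟ x ⟧ (λ v → wk (t e) v y))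
                                            (cong (⟦ s e ≟ x ⟧ *_) (∑ⁿ-wk k (t e) y)))

  ∑-δʳ : ∀ c (F : V → ℕ) → (∑[ x ← 𝕍 ] F x * ⟦ c ≟ x ⟧) ≡ F c
  ∑-δʳ c F = trans (∑-cong 𝕍 (λ x → *-comm (F x) _)) (∑-δ c F)

  wk-++ : ∀ x u v z → wk x (u ++ v) z ≡ (∑[ y ← 𝕍 ] wk x u y * wk y v z)
  wk-++ x []      v z = sym (∑-δ x (λ y → wk y v z))
  wk-++ x (e ∷ u) v z = trans (cong (⟦ s e ≟ x ⟧ *_) (wk-++ (t e) u v z))
    (trans (sym (∑-*ˡ 𝕍 ⟦ s e ≟ x ⟧ _))
           (∑-cong 𝕍 (λ y → sym (*-assoc ⟦ s e ≟ x ⟧ (wk (t e) u y) (wk y v z)))))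

  p-+ : ∀ i j x z → p (i + j) x z ≡ (∑[ y ← 𝕍 ] p i x y * p j y z)
  p-+ zero    j x z = sym (∑-δ x (λ y → p j y z))
  p-+ (suc i) j x z = begin
    (∑[ e ← 𝔼 ] ⟦ s e ≟ x ⟧ * p (i + j) (t e) z)
      ≡⟨ ∑-cong 𝔼 (λ e → trans (cong (⟦ s e ≟ x ⟧ *_) (p-+ i j (t e) z)) (sym (∑-*ˡ 𝕍 ⟦ s e ≟ x ⟧ _))) ⟩
    (∑[ e ← 𝔼 ] ∑[ y ← 𝕍 ] ⟦ s e ≟ x ⟧ * (p i (t e) y * p j y z))
      ≡⟨ ∑-swap 𝔼 𝕍 _ ⟩
    (∑[ y ← 𝕍 ] ∑[ e ← 𝔼 ] ⟦ s e ≟ x ⟧ * (p i (t e) y * p j y z))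
      ≡⟨ ∑-cong 𝕍 (λ y → trans (∑-cong 𝔼 (λ e → sym (*-assoc ⟦ s e ≟ x ⟧ _ _)))
                               (∑-*ʳ 𝔼 (λ e → ⟦ s e ≟ x ⟧ * p i (t e) y) (p j y z))) ⟩
    (∑[ y ← 𝕍 ] p (suc i) x y * p j y z) ∎
    where open ≡-Reasoning

  -- Split off the first step, reverse it and the rest, and attach the step at the other end.
  p-sym : ∀ k x y → p k x y ≡ p k y x
  p-sym zero    x y = ⟦⟧-cong (x ≟ y) (y ≟ x) sym sym
  p-sym (suc k) x y = begin
    p (suc k) x y                    ≡⟨ p-+ 1 k x y ⟩
    (∑[ z ← 𝕍 ] p 1 x z * p k z y)   ≡⟨ ∑-cong 𝕍 (λ z → cong₂ _*_ (reversible x z) (p-sym k z y)) ⟩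
    (∑[ z ← 𝕍 ] p 1 z x * p k y z)   ≡⟨ ∑-cong 𝕍 (λ z → *-comm (p 1 z x) (p k y z)) ⟩
    (∑[ z ← 𝕍 ] p k y z * p 1 z x)   ≡⟨ sym (p-+ k 1 y x) ⟩
    p (k + 1) y x                    ≡⟨ cong (λ n → p n y x) (+-comm k 1) ⟩
    p (suc k) y x ∎
    where open ≡-Reasoning

  -- A closed walk of length 2k is a pair of k-walks with common ends, one of them reversed; hence
  -- the sum of squares, identified with the count in `∑ⁿ-cl`.
  S : ℕ → ℕ
  S k = ∑[ x ← 𝕍 ] ∑[ y ← 𝕍 ] p k x y * p k x y

  -- For a nonempty list only `x = s e` of its first edge `e` can contribute, so the value is 0 or
  -- 1; for `[]` it is the number of vertices, in agreement with `S 0`.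
  cl : List E → ℕ
  cl v = ∑[ x ← 𝕍 ] wk x v x

  ∑ⁿ-cl : ∀ k → ∑ⁿ 𝔼 (k + k) cl ≡ S k
  ∑ⁿ-cl k = trans (∑ⁿ-∑ 𝔼 (k + k) 𝕍 (λ v x → wk x v x)) (∑-cong 𝕍 (λ x →
    trans (∑ⁿ-wk (k + k) x x) (trans (p-+ k k x x) (∑-cong 𝕍 (λ y → cong (p k x y *_) (p-sym k y x))))))

  cl-∷ : ∀ e v → cl (e ∷ v) ≡ wk (t e) v (s e)
  cl-∷ e v = ∑-δ (s e) (λ x → wk (t e) v x)

  -- The cyclicity of the trace.
  cl-rot : ∀ v → cl (rot v) ≡ cl v
  cl-rot []      = refl
  cl-rot (e ∷ v) = begin
    (∑[ x ← 𝕍 ] wk x (v ++ e ∷ []) x)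
      ≡⟨ ∑-cong 𝕍 (λ x → wk-++ x v (e ∷ []) x) ⟩
    (∑[ x ← 𝕍 ] ∑[ y ← 𝕍 ] wk x v y * (⟦ s e ≟ y ⟧ * ⟦ t e ≟ x ⟧))
      ≡⟨ ∑-cong 𝕍 (λ x → trans (∑-cong 𝕍 (λ y →
           solve 3 (λ a b c → a :* (b :* c) := b :* (a :* c)) refl (wk x v y) ⟦ s e ≟ y ⟧ ⟦ t e ≟ x ⟧))
           (∑-δ (s e) (λ y → wk x v y * ⟦ t e ≟ x ⟧))) ⟩
    (∑[ x ← 𝕍 ] wk x v (s e) * ⟦ t e ≟ x ⟧)
      ≡⟨ ∑-δʳ (t e) (λ x → wk x v (s e)) ⟩
    wk (t e) v (s e)
      ≡⟨ sym (cl-∷ e v) ⟩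
    cl (e ∷ v) ∎
    where open ≡-Reasoning

  ∑ⁿ-cl-rot^ : ∀ n a (F : List E → ℕ) → ∑ⁿ 𝔼 n (λ v → cl v * F (rot^ a v)) ≡ ∑ⁿ 𝔼 n (λ v → cl v * F v)
  ∑ⁿ-cl-rot^ n zero    F = refl
  ∑ⁿ-cl-rot^ n (suc a) F = begin
    ∑ⁿ 𝔼 n (λ v → cl v * F (rot^ a (rot v)))       ≡⟨ ∑ⁿ-cong 𝔼 n (λ v _ → cong (_* F (rot^ a (rot v))) (sym (cl-rot v))) ⟩
    ∑ⁿ 𝔼 n (λ v → cl (rot v) * F (rot^ a (rot v))) ≡⟨ ∑ⁿ-rot 𝔼 n (λ v → cl v * F (rot^ a v)) ⟩
    ∑ⁿ 𝔼 n (λ v → cl v * F (rot^ a v))             ≡⟨ ∑ⁿ-cl-rot^ n a F ⟩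
    ∑ⁿ 𝔼 n (λ v → cl v * F v) ∎
    where open ≡-Reasoning

  wk-links : ∀ e v y → 1 ≤ wk (t e) v y →
             (∀ i → s (lookup v i) ≡ t (lookup (e ∷ v) (inject₁ i))) × t (lookup (e ∷ v) (fromℕ (length v))) ≡ y
  wk-links e []      y pos = (λ ()) , ⟦⟧-pos (t e ≟ y) pos
  wk-links e (f ∷ v) y pos with s f ≟ t e
  ... | yes sf≡te with wk-links f v y (subst (1 ≤_) (+-identityʳ _) pos)
  ...   | links , last = (λ { zero → sf≡te ; (suc i) → links i }) , last

  closed-links : ∀ e v → 1 ≤ cl (e ∷ v) → ∀ i → s (lookup (e ∷ v) i) ≡ t (lookup (e ∷ v) (prev i))
  closed-links e v pos i with wk-links e v (s e) (subst (1 ≤_) (cl-∷ e v) pos)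
  closed-links e v pos zero    | links , last = sym last
  closed-links e v pos (suc i) | links , last = links i

  N M : ℕ
  N = length 𝕍
  M = length 𝔼

  r : ℕ → V → ℕ
  r k x = ∑[ y ← 𝕍 ] p k x y

  w : ℕ → ℕ
  w k = ∑[ x ← 𝕍 ] r k x

  ∑-δ-1 : ∀ c → (∑[ x ← 𝕍 ] ⟦ c ≟ x ⟧) ≡ 1
  ∑-δ-1 c = trans (∑-cong 𝕍 (λ x → sym (*-identityʳ _))) (∑-δ c (λ _ → 1))

  w-+ : ∀ i j → w (i + j) ≡ (∑[ x ← 𝕍 ] r i x * r j x)
  w-+ i j = begin
    (∑[ x ← 𝕍 ] ∑[ z ← 𝕍 ] p (i + j) x z)
      ≡⟨ ∑-cong 𝕍 (λ x → ∑-cong 𝕍 (λ z → p-+ i j x z)) ⟩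
    (∑[ x ← 𝕍 ] ∑[ z ← 𝕍 ] ∑[ y ← 𝕍 ] p i x y * p j y z)
      ≡⟨ ∑-cong 𝕍 (λ x → trans (∑-swap 𝕍 𝕍 _) (∑-cong 𝕍 (λ y → ∑-*ˡ 𝕍 (p i x y) (p j y)))) ⟩
    (∑[ x ← 𝕍 ] ∑[ y ← 𝕍 ] p i x y * r j y)
      ≡⟨ ∑-swap 𝕍 𝕍 _ ⟩
    (∑[ y ← 𝕍 ] ∑[ x ← 𝕍 ] p i x y * r j y)
      ≡⟨ ∑-cong 𝕍 (λ y → trans (∑-*ʳ 𝕍 (λ x → p i x y) (r j y))
                               (cong (_* r j y) (∑-cong 𝕍 (λ x → p-sym i x y)))) ⟩
    (∑[ y ← 𝕍 ] r i y * r j y) ∎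
    where open ≡-Reasoning

  r-0 : ∀ x → r 0 x ≡ 1
  r-0 = ∑-δ-1

  w-0 : w 0 ≡ N
  w-0 = trans (∑-cong 𝕍 r-0) (trans (∑-const 𝕍 1) (*-identityʳ N))

  w-1 : w 1 ≡ M
  w-1 = begin
    (∑[ x ← 𝕍 ] ∑[ y ← 𝕍 ] ∑[ e ← 𝔼 ] ⟦ s e ≟ x ⟧ * ⟦ t e ≟ y ⟧)
      ≡⟨ ∑-cong 𝕍 (λ x → trans (∑-swap 𝕍 𝔼 _) (∑-cong 𝔼 (λ e →
           trans (∑-*ˡ 𝕍 ⟦ s e ≟ x ⟧ _) (cong (⟦ s e ≟ x ⟧ *_) (∑-δ-1 (t e)))))) ⟩
    (∑[ x ← 𝕍 ] ∑[ e ← 𝔼 ] ⟦ s e ≟ x ⟧ * 1)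
      ≡⟨ ∑-swap 𝕍 𝔼 _ ⟩
    (∑[ e ← 𝔼 ] ∑[ x ← 𝕍 ] ⟦ s e ≟ x ⟧ * 1)
      ≡⟨ trans (∑-cong 𝔼 (λ e → ∑-δ (s e) (λ _ → 1))) (trans (∑-const 𝔼 1) (*-identityʳ M)) ⟩
    M ∎
    where open ≡-Reasoning

  -- Only even lengths are used: there the log-convexity is a single Cauchy-Schwarz inequality
  -- between the vectors `r j` and `r (j + 2)`.
  b : ℕ → ℕ
  b j = w (j + j)

  b-logconvex : ∀ j → b (suc j) * b (suc j) ≤ b j * b (suc (suc j))
  b-logconvex j = subst₂ _≤_
    (cong₂ _*_ eq eq)
    (cong₂ _*_ (sym (w-+ j j)) (sym (w-+ (suc (suc j)) (suc (suc j)))))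
    (cauchy 𝕍 (r j) (r (suc (suc j))))
    where
    eq : (∑[ x ← 𝕍 ] r j x * r (suc (suc j)) x) ≡ b (suc j)
    eq = trans (sym (w-+ j (suc (suc j)))) (cong w (+-suc j (suc j)))

  -- By log-convexity the ratios `b (suc j) / b j` do not decrease, and the first one is at least
  -- (M/N)² by Cauchy-Schwarz. The induction cancels `b (suc j)`; if that is zero, the claim is
  -- trivial.
  b-ratio : ∀ j → b j * (M * M) ≤ b (suc j) * (N * N)
  b-ratio zero = subst₂ _≤_
    (cong (_* (M * M)) (sym w-0))
    (solve 2 (λ n b → n :* (n :* b) := b :* (n :* n)) refl N (b 1))
    (*-monoʳ-≤ N (subst₂ _≤_ (cong₂ _*_ w-1 w-1) (cong (N *_) (sym (w-+ 1 1))) (cauchy-1 𝕍 (r 1))))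
  b-ratio (suc j) with b (suc j) in eq
  ... | zero  = z≤n
  ... | suc c = *-cancelˡ-≤ (suc c) (begin
    suc c * (suc c * (M * M))             ≡⟨ sym (*-assoc (suc c) (suc c) _) ⟩
    suc c * suc c * (M * M)               ≡⟨ cong (λ z → z * z * (M * M)) (sym eq) ⟩
    b (suc j) * b (suc j) * (M * M)       ≤⟨ *-monoˡ-≤ (M * M) (b-logconvex j) ⟩
    b j * b (suc (suc j)) * (M * M)
      ≡⟨ solve 3 (λ x y m → x :* y :* m := x :* m :* y) refl (b j) (b (suc (suc j))) (M * M) ⟩
    b j * (M * M) * b (suc (suc j))       ≤⟨ *-monoˡ-≤ (b (suc (suc j))) (b-ratio j) ⟩
    b (suc j) * (N * N) * b (suc (suc j))
      ≡⟨ solve 3 (λ x y m → x :* m :* y := x :* (y :* m)) refl (b (suc j)) (b (suc (suc j))) (N * N) ⟩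
    b (suc j) * (b (suc (suc j)) * (N * N)) ≡⟨ cong (_* (b (suc (suc j)) * (N * N))) eq ⟩
    suc c * (b (suc (suc j)) * (N * N)) ∎)
    where open ≤-Reasoning

  b-lower : ∀ j → N * (M * M) ^ j ≤ b j * (N * N) ^ j
  b-lower zero    = ≤-reflexive (cong (_* 1) (sym w-0))
  b-lower (suc j) = begin
    N * (M * M * (M * M) ^ j)
      ≡⟨ solve 3 (λ n m p → n :* (m :* p) := n :* p :* m) refl N (M * M) ((M * M) ^ j) ⟩
    N * (M * M) ^ j * (M * M)        ≤⟨ *-monoˡ-≤ (M * M) (b-lower j) ⟩
    b j * (N * N) ^ j * (M * M)
      ≡⟨ solve 3 (λ b p m → b :* p :* m := b :* m :* p) refl (b j) ((N * N) ^ j) (M * M) ⟩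
    b j * (M * M) * (N * N) ^ j      ≤⟨ *-monoˡ-≤ ((N * N) ^ j) (b-ratio j) ⟩
    b (suc j) * (N * N) * (N * N) ^ j ≡⟨ *-assoc (b (suc j)) (N * N) ((N * N) ^ j) ⟩
    b (suc j) * (N * N) ^ suc j ∎
    where open ≤-Reasoning

  -- Cauchy-Schwarz in each row of the matrix `p k`.
  b≤NS : ∀ k → b k ≤ N * S k
  b≤NS k = begin
    b k                                  ≡⟨ w-+ k k ⟩
    (∑[ x ← 𝕍 ] r k x * r k x)           ≤⟨ ∑-mono 𝕍 (λ {x} _ → cauchy-1 𝕍 (p k x)) ⟩
    (∑[ x ← 𝕍 ] N * (∑[ y ← 𝕍 ] p k x y * p k x y)) ≡⟨ ∑-*ˡ 𝕍 N _ ⟩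
    N * S k ∎
    where open ≤-Reasoning

  S-0 : S 0 ≡ N
  S-0 = trans (∑-cong 𝕍 (λ x → trans (∑-δ x (λ y → ⟦ x ≟ y ⟧)) (⟦⟧-yes (x ≟ x) refl)))
              (trans (∑-const 𝕍 1) (*-identityʳ N))

  -- Upper bound for closed walks that always contain a conflict

  module Conflicts (χ : E → E → ℕ) (χ-sym : ∀ e f → χ e f ≡ χ f e) (c D : ℕ) .{{_ : NonZero c}}
    (χ≤c : ∀ e f → χ e f ≤ c)
    (out-conflicts : ∀ x {f} → f ∈ 𝔼 → (∑[ e ← 𝔼 ] ⟦ s e ≟ x ⟧ * χ e f) ≤ c)
    (in-degree : ∀ x → (∑[ e ← 𝔼 ] ⟦ t e ≟ x ⟧) ≤ D)
    where

    open Rotation χ χ-sym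

    ConflictFree : List E → Set
    ConflictFree = AllPairs (λ e f → χ e f ≡ 0)

    X : E → List E → ℕ
    X e R = ∑[ f ← R ] χ e f

    module _ (k : ℕ) where

      -- `q` is the coefficient with which `S K` returns on the right-hand side of `S-step`: a
      -- factor 2K from the rotations and Kc from `∑-out`. The weight `L` is twice that, so half of
      -- the left-hand side survives the subtraction.
      K q L : ℕ
      K = suc k
      q = 2 * (K * K) * c
      L = q + q

      ρ : V → E → V → ℕ
      ρ y e x = ∑ⁿ 𝔼 K (λ R → wk y R x * X e R)

      T : ℕ
      T = ∑ⁿ 𝔼 (K + K) (λ v → cl v * g k v)

      -- Every closed walk has a rotation counted by `g k`, and by rotation invariance each of the K
      -- + K rotations contributes the same total `T`.
      S≤T : (∀ v → length v ≡ K + K → All (_∈ 𝔼) v → 1 ≤ cl v → ConflictFree v → ⊥) →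
            S K ≤ (K + K) * T
      S≤T bad = begin
        S K
          ≡⟨ sym (∑ⁿ-cl K) ⟩
        ∑ⁿ 𝔼 (K + K) cl
          ≤⟨ ∑ⁿ-mono 𝔼 (K + K) covered ⟩
        ∑ⁿ 𝔼 (K + K) (λ v → ∑[ a ← upTo (K + K) ] cl v * g k (rot^ a v))
          ≡⟨ ∑ⁿ-∑ 𝔼 (K + K) (upTo (K + K)) (λ v a → cl v * g k (rot^ a v)) ⟩
        (∑[ a ← upTo (K + K) ] ∑ⁿ 𝔼 (K + K) (λ v → cl v * g k (rot^ a v)))
          ≡⟨ ∑-cong (upTo (K + K)) (λ a → ∑ⁿ-cl-rot^ (K + K) a (g k)) ⟩
        (∑[ a ← upTo (K + K) ] T)
          ≡⟨ trans (∑-const (upTo (K + K)) T) (cong (_* T) (length-upTo (K + K))) ⟩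
        (K + K) * T ∎
        where
        open ≤-Reasoning
        covered : ∀ v → length v ≡ K + K → All (_∈ 𝔼) v →
                  cl v ≤ (∑[ a ← upTo (K + K) ] cl v * g k (rot^ a v))
        covered v len v∈ with cl v in eq
        ... | zero  = z≤n
        ... | suc m = ≤-trans
          (subst (_≤ suc m * (∑[ a ← upTo (K + K) ] g k (rot^ a v))) (*-identityʳ (suc m))
            (*-monoʳ-≤ (suc m) (cover k v len (bad v len v∈ (subst (1 ≤_) (sym eq) (s≤s z≤n))))))
          (≤-reflexive (sym (∑-*ˡ (upTo (K + K)) (suc m) _)))

      -- The walk is cut into its first dart `e`, an arc `P` of k darts from `t e` to `y`, and an
      -- arc `R` of K darts from `y` back to `s e`; only `R` is tested for conflicts with `e`.
      T-split : T ≡ (∑[ e ← 𝔼 ] ∑[ y ← 𝕍 ] p k (t e) y * ρ y e (s e))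
      T-split = ∑-cong 𝔼 λ e → begin
        ∑ⁿ 𝔼 (k + K) (λ u → cl (e ∷ u) * X e (drop k u))
          ≡⟨ ∑ⁿ-++ 𝔼 k K (λ u → cl (e ∷ u) * X e (drop k u)) ⟩
        ∑ⁿ 𝔼 k (λ P → ∑ⁿ 𝔼 K (λ R → cl (e ∷ P ++ R) * X e (drop k (P ++ R))))
          ≡⟨ ∑ⁿ-cong 𝔼 k (λ P len → trans (∑ⁿ-cong 𝔼 K (λ R _ → expand e P R len)) (factor e P)) ⟩
        ∑ⁿ 𝔼 k (λ P → ∑[ y ← 𝕍 ] wk (t e) P y * ρ y e (s e))
          ≡⟨ ∑ⁿ-∑ 𝔼 k 𝕍 (λ P y → wk (t e) P y * ρ y e (s e)) ⟩
        (∑[ y ← 𝕍 ] ∑ⁿ 𝔼 k (λ P → wk (t e) P y * ρ y e (s e)))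
          ≡⟨ ∑-cong 𝕍 (λ y → trans (∑ⁿ-*ʳ 𝔼 k (λ P → wk (t e) P y) (ρ y e (s e)))
                                   (cong (_* ρ y e (s e)) (∑ⁿ-wk k (t e) y))) ⟩
        (∑[ y ← 𝕍 ] p k (t e) y * ρ y e (s e)) ∎
        where
        open ≡-Reasoning
        expand : ∀ e P R → length P ≡ k → cl (e ∷ P ++ R) * X e (drop k (P ++ R)) ≡
                 (∑[ y ← 𝕍 ] wk (t e) P y * (wk y R (s e) * X e R))
        expand e P R refl = begin
          cl (e ∷ P ++ R) * X e (drop k (P ++ R))
            ≡⟨ cong₂ _*_ (trans (cl-∷ e (P ++ R)) (wk-++ (t e) P R (s e))) (cong (X e) (drop-++ˡ P R)) ⟩
          (∑[ y ← 𝕍 ] wk (t e) P y * wk y R (s e)) * X e R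
            ≡⟨ sym (∑-*ʳ 𝕍 _ (X e R)) ⟩
          (∑[ y ← 𝕍 ] wk (t e) P y * wk y R (s e) * X e R)
            ≡⟨ ∑-cong 𝕍 (λ y → *-assoc (wk (t e) P y) _ _) ⟩
          (∑[ y ← 𝕍 ] wk (t e) P y * (wk y R (s e) * X e R)) ∎
        factor : ∀ e P → ∑ⁿ 𝔼 K (λ R → ∑[ y ← 𝕍 ] wk (t e) P y * (wk y R (s e) * X e R)) ≡
                 (∑[ y ← 𝕍 ] wk (t e) P y * ρ y e (s e))
        factor e P = trans (∑ⁿ-∑ 𝔼 K 𝕍 (λ R y → wk (t e) P y * (wk y R (s e) * X e R)))
          (∑-cong 𝕍 (λ y → ∑ⁿ-*ˡ 𝔼 K (wk (t e) P y) (λ R → wk y R (s e) * X e R)))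

      ρ≤ : ∀ y e x → ρ y e x ≤ p K y x * (K * c)
      ρ≤ y e x = begin
        ∑ⁿ 𝔼 K (λ R → wk y R x * X e R)
          ≤⟨ ∑ⁿ-mono 𝔼 K (λ R len _ → *-monoʳ-≤ (wk y R x) (≤-trans
               (∑-mono R (λ {f} _ → χ≤c e f)) (≤-reflexive (trans (∑-const R c) (cong (_* c) len))))) ⟩
        ∑ⁿ 𝔼 K (λ R → wk y R x * (K * c))
          ≡⟨ trans (∑ⁿ-*ʳ 𝔼 K (λ R → wk y R x) (K * c)) (cong (_* (K * c)) (∑ⁿ-wk K y x)) ⟩
        p K y x * (K * c) ∎
        where open ≤-Reasoning

      -- Darts are grouped by their target: each row of `S k` occurs at most `D` times.
      ∑-in : (∑[ e ← 𝔼 ] ∑[ y ← 𝕍 ] p k (t e) y * p k (t e) y) ≤ D * S k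
      ∑-in = begin
        (∑[ e ← 𝔼 ] F (t e))
          ≡⟨ ∑-cong 𝔼 (λ e → sym (∑-δ (t e) F)) ⟩
        (∑[ e ← 𝔼 ] ∑[ x ← 𝕍 ] ⟦ t e ≟ x ⟧ * F x)
          ≡⟨ trans (∑-swap 𝔼 𝕍 _) (∑-cong 𝕍 (λ x → ∑-*ʳ 𝔼 (λ e → ⟦ t e ≟ x ⟧) (F x))) ⟩
        (∑[ x ← 𝕍 ] (∑[ e ← 𝔼 ] ⟦ t e ≟ x ⟧) * F x)
          ≤⟨ ∑-mono 𝕍 (λ {x} _ → *-monoˡ-≤ (F x) (in-degree x)) ⟩
        (∑[ x ← 𝕍 ] D * F x)
          ≡⟨ ∑-*ˡ 𝕍 D F ⟩
        D * S k ∎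
        where
        open ≤-Reasoning
        F : V → ℕ
        F x = ∑[ y ← 𝕍 ] p k x y * p k x y

      -- No factor `D` is lost here. For a fixed long arc `R` ending at `x`, `out-conflicts` limits
      -- the conflicts between `R` and the darts leaving `x` to a constant per dart of `R`, so the
      -- sum over `e` is carried out inside the sum over `R`.
      ∑-out : (∑[ e ← 𝔼 ] ∑[ y ← 𝕍 ] p K y (s e) * ρ y e (s e)) ≤ S K * (K * c)
      ∑-out = begin
        (∑[ e ← 𝔼 ] ∑[ y ← 𝕍 ] p K y (s e) * ρ y e (s e))
          ≡⟨ ∑-cong 𝔼 (λ e → sym (∑-δ (s e) (λ x → ∑[ y ← 𝕍 ] p K y x * ρ y e x))) ⟩
        (∑[ e ← 𝔼 ] ∑[ x ← 𝕍 ] ⟦ s e ≟ x ⟧ * (∑[ y ← 𝕍 ] p K y x * ρ y e x))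
          ≡⟨ ∑-swap 𝔼 𝕍 _ ⟩
        (∑[ x ← 𝕍 ] ∑[ e ← 𝔼 ] ⟦ s e ≟ x ⟧ * (∑[ y ← 𝕍 ] p K y x * ρ y e x))
          ≡⟨ ∑-cong 𝕍 (λ x → trans (∑-cong 𝔼 (λ e → trans (sym (∑-*ˡ 𝕍 ⟦ s e ≟ x ⟧ _))
               (∑-cong 𝕍 (λ y → solve 3 (λ a b c → a :* (b :* c) := b :* (a :* c)) refl
                 ⟦ s e ≟ x ⟧ (p K y x) (ρ y e x)))))
               (trans (∑-swap 𝔼 𝕍 _) (∑-cong 𝕍 (λ y → ∑-*ˡ 𝔼 (p K y x) _)))) ⟩
        (∑[ x ← 𝕍 ] ∑[ y ← 𝕍 ] p K y x * (∑[ e ← 𝔼 ] ⟦ s e ≟ x ⟧ * ρ y e x))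
          ≤⟨ ∑-mono 𝕍 (λ {x} _ → ∑-mono 𝕍 (λ {y} _ → *-monoʳ-≤ (p K y x) (inner x y))) ⟩
        (∑[ x ← 𝕍 ] ∑[ y ← 𝕍 ] p K y x * (p K y x * (K * c)))
          ≡⟨ ∑-cong 𝕍 (λ x → trans (∑-cong 𝕍 (λ y → trans (sym (*-assoc (p K y x) (p K y x) (K * c)))
               (cong (λ z → z * z * (K * c)) (p-sym K y x)))) (∑-*ʳ 𝕍 _ (K * c))) ⟩
        (∑[ x ← 𝕍 ] (∑[ y ← 𝕍 ] p K x y * p K x y) * (K * c))
          ≡⟨ ∑-*ʳ 𝕍 _ (K * c) ⟩
        S K * (K * c) ∎
        where
        open ≤-Reasoning
        few : ∀ x R → length R ≡ K → All (_∈ 𝔼) R → (∑[ e ← 𝔼 ] ⟦ s e ≟ x ⟧ * X e R) ≤ K * c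
        few x R len R∈ = begin
          (∑[ e ← 𝔼 ] ⟦ s e ≟ x ⟧ * X e R)
            ≡⟨ ∑-cong 𝔼 (λ e → sym (∑-*ˡ R ⟦ s e ≟ x ⟧ (χ e))) ⟩
          (∑[ e ← 𝔼 ] ∑[ f ← R ] ⟦ s e ≟ x ⟧ * χ e f)
            ≡⟨ ∑-swap 𝔼 R _ ⟩
          (∑[ f ← R ] ∑[ e ← 𝔼 ] ⟦ s e ≟ x ⟧ * χ e f)
            ≤⟨ ∑-mono R (λ f∈ → out-conflicts x (All.lookup R∈ f∈)) ⟩
          (∑[ f ← R ] c)
            ≡⟨ trans (∑-const R c) (cong (_* c) len) ⟩
          K * c ∎
        inner : ∀ x y → (∑[ e ← 𝔼 ] ⟦ s e ≟ x ⟧ * ρ y e x) ≤ p K y x * (K * c)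
        inner x y = begin
          (∑[ e ← 𝔼 ] ⟦ s e ≟ x ⟧ * ρ y e x)
            ≡⟨ ∑-cong 𝔼 (λ e → sym (∑ⁿ-*ˡ 𝔼 K ⟦ s e ≟ x ⟧ (λ R → wk y R x * X e R))) ⟩
          (∑[ e ← 𝔼 ] ∑ⁿ 𝔼 K (λ R → ⟦ s e ≟ x ⟧ * (wk y R x * X e R)))
            ≡⟨ sym (∑ⁿ-∑ 𝔼 K 𝔼 (λ R e → ⟦ s e ≟ x ⟧ * (wk y R x * X e R))) ⟩
          ∑ⁿ 𝔼 K (λ R → ∑[ e ← 𝔼 ] ⟦ s e ≟ x ⟧ * (wk y R x * X e R))
            ≡⟨ ∑ⁿ-cong 𝔼 K (λ R _ → trans
                 (∑-cong 𝔼 (λ e → solve 3 (λ a b c → a :* (b :* c) := b :* (a :* c)) refl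
                   ⟦ s e ≟ x ⟧ (wk y R x) (X e R)))
                 (∑-*ˡ 𝔼 (wk y R x) _)) ⟩
          ∑ⁿ 𝔼 K (λ R → wk y R x * (∑[ e ← 𝔼 ] ⟦ s e ≟ x ⟧ * X e R))
            ≤⟨ ∑ⁿ-mono 𝔼 K (λ R len R∈ → *-monoʳ-≤ (wk y R x) (few x R len R∈)) ⟩
          ∑ⁿ 𝔼 K (λ R → wk y R x * (K * c))
            ≡⟨ trans (∑ⁿ-*ʳ 𝔼 K (λ R → wk y R x) (K * c)) (cong (_* (K * c)) (∑ⁿ-wk K y x)) ⟩
          p K y x * (K * c) ∎

      -- α counts the walks along the first arc and β those along the second one; ρ ≤ β (K c)
      -- is used when β < L α, and the scarcity of conflicting first edges when L α ≤ β.
      balance : ∀ α β ρ′ → ρ′ ≤ β * (K * c) → L * (α * ρ′) ≤ K * c * (L * L) * (α * α) + β * ρ′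
      balance α β ρ′ ρ′≤ with ≤-total (L * α) β
      ... | inj₁ Lα≤β = ≤-trans (≤-reflexive (sym (*-assoc L α ρ′)))
                          (≤-trans (*-monoˡ-≤ ρ′ Lα≤β) (m≤n+m _ _))
      ... | inj₂ β≤Lα = ≤-trans (begin
        L * (α * ρ′)                       ≤⟨ *-monoʳ-≤ L (*-monoʳ-≤ α ρ′≤) ⟩
        L * (α * (β * (K * c)))            ≤⟨ *-monoʳ-≤ L (*-monoʳ-≤ α (*-monoˡ-≤ (K * c) β≤Lα)) ⟩
        L * (α * (L * α * (K * c)))
          ≡⟨ solve 3 (λ l a z → l :* (a :* (l :* a :* z)) := z :* (l :* l) :* (a :* a)) refl L α (K * c) ⟩
        K * c * (L * L) * (α * α) ∎) (m≤m+n _ _)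
        where open ≤-Reasoning

      LT≤ : L * T ≤ K * c * (L * L) * (D * S k) + S K * (K * c)
      LT≤ = begin
        L * T
          ≡⟨ cong (L *_) T-split ⟩
        L * (∑[ e ← 𝔼 ] ∑[ y ← 𝕍 ] p k (t e) y * ρ y e (s e))
          ≡⟨ trans (sym (∑-*ˡ 𝔼 L _)) (∑-cong 𝔼 (λ e → sym (∑-*ˡ 𝕍 L _))) ⟩
        (∑[ e ← 𝔼 ] ∑[ y ← 𝕍 ] L * (p k (t e) y * ρ y e (s e)))
          ≤⟨ ∑-mono 𝔼 (λ {e} _ → ∑-mono 𝕍 (λ {y} _ →
               balance (p k (t e) y) (p K y (s e)) (ρ y e (s e)) (ρ≤ y e (s e)))) ⟩
        (∑[ e ← 𝔼 ] ∑[ y ← 𝕍 ] (K * c * (L * L) * (p k (t e) y * p k (t e) y) + p K y (s e) * ρ y e (s e)))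
          ≡⟨ trans (∑-cong 𝔼 (λ e → trans (∑-+ 𝕍 _ _) (cong₂ _+_ (∑-*ˡ 𝕍 (K * c * (L * L)) _) refl)))
                   (trans (∑-+ 𝔼 _ _) (cong₂ _+_ (∑-*ˡ 𝔼 (K * c * (L * L)) _) refl)) ⟩
        K * c * (L * L) * (∑[ e ← 𝔼 ] ∑[ y ← 𝕍 ] p k (t e) y * p k (t e) y)
          + (∑[ e ← 𝔼 ] ∑[ y ← 𝕍 ] p K y (s e) * ρ y e (s e))
          ≤⟨ +-mono-≤ (*-monoʳ-≤ (K * c * (L * L)) ∑-in) ∑-out ⟩
        K * c * (L * L) * (D * S k) + S K * (K * c) ∎
        where open ≤-Reasoning

      S-step : (∀ v → length v ≡ K + K → All (_∈ 𝔼) v → 1 ≤ cl v → ConflictFree v → ⊥) →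
               S K ≤ L * L * D * S k
      S-step bad = *-cancelˡ-≤ q {{m*n≢0 (2 * (K * K)) c}} (+-cancelʳ-≤ (q * S K) _ _ (begin
        q * S K + q * S K
          ≡⟨ sym (*-distribʳ-+ (S K) q q) ⟩
        L * S K
          ≤⟨ *-monoʳ-≤ L (S≤T bad) ⟩
        L * ((K + K) * T)
          ≡⟨ solve 3 (λ l k t → l :* (k :* t) := k :* (l :* t)) refl L (K + K) T ⟩
        (K + K) * (L * T)
          ≤⟨ *-monoʳ-≤ (K + K) LT≤ ⟩
        (K + K) * (K * c * (L * L) * (D * S k) + S K * (K * c))
          ≡⟨ solve 6 (λ k c l d s s′ → (k :+ k) :* (k :* c :* l :* (d :* s) :+ s′ :* (k :* c))
               := con 2 :* (k :* k) :* c :* (l :* d :* s) :+ con 2 :* (k :* k) :* c :* s′)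
               refl K c (L * L) D (S k) (S K) ⟩
        q * (L * L * D * S k) + q * S K ∎))
        where open ≤-Reasoning

    -- `L` increases, so its value at ℓ serves all steps below ℓ.
    bound : ℕ → ℕ
    bound ℓ = L ℓ * L ℓ

    L-mono : ∀ {j k} → j ≤ k → L j ≤ L k
    L-mono j≤k = +-mono-≤ q≤ q≤
      where q≤ = *-monoˡ-≤ c (*-monoʳ-≤ 2 (*-mono-≤ (s≤s j≤k) (s≤s j≤k)))

    S-upper : ∀ ℓ → (∀ k v → k < ℓ → length v ≡ K k + K k → All (_∈ 𝔼) v → 1 ≤ cl v → ConflictFree v → ⊥) →
              ∀ k → k ≤ ℓ → S k ≤ (bound ℓ * D) ^ k * N
    S-upper ℓ bad zero    _   = ≤-reflexive (trans S-0 (sym (+-identityʳ N)))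
    S-upper ℓ bad (suc k) k<ℓ = begin
      S (suc k)                            ≤⟨ S-step k (λ v → bad k v k<ℓ) ⟩
      L k * L k * D * S k                  ≤⟨ *-mono-≤ (*-monoˡ-≤ D (*-mono-≤ (L-mono (<⇒≤ k<ℓ)) (L-mono (<⇒≤ k<ℓ))))
                                                       (S-upper ℓ bad k (<⇒≤ k<ℓ)) ⟩
      bound ℓ * D * ((bound ℓ * D) ^ k * N) ≡⟨ sym (*-assoc (bound ℓ * D) _ N) ⟩
      (bound ℓ * D) ^ suc k * N ∎
      where open ≤-Reasoning

    edge-bound : ∀ ℓ → (∀ k v → k < ℓ → length v ≡ K k + K k → All (_∈ 𝔼) v → 1 ≤ cl v → ConflictFree v → ⊥) →
                 N * (M * M) ^ ℓ ≤ N * ((bound ℓ * D) ^ ℓ * N) * (N * N) ^ ℓ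
    edge-bound ℓ bad = ≤-trans (b-lower ℓ) (*-monoˡ-≤ ((N * N) ^ ℓ)
      (≤-trans (b≤NS ℓ) (*-monoʳ-≤ N (S-upper ℓ bad ℓ ≤-refl))))

-- Sums over lists without repetition

∑-null : ∀ (xs : List A) {f} → (∀ {x} → x ∈ xs → f x ≡ 0) → ∑ xs f ≡ 0
∑-null xs h = trans (∑-cong-∈ xs h) (∑-zero xs)

∑-≤1 : ∀ {xs : List A} {f} → Unique xs → (∀ x → f x ≤ 1) →
       (∀ {x y} → x ∈ xs → y ∈ xs → 1 ≤ f x → 1 ≤ f y → x ≡ y) → ∑ xs f ≤ 1
∑-≤1 {xs = []}     _          _   _   = z≤n
∑-≤1 {xs = x ∷ xs} {f} (x∉ ∷ u) f≤1 inj with f x in eq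
... | zero  = ∑-≤1 u f≤1 (λ y∈ z∈ → inj (there y∈) (there z∈))
... | suc m = ≤-trans (≤-reflexive (cong (suc m +_) (∑-null xs rest)))
                (≤-trans (≤-reflexive (+-identityʳ (suc m))) (subst (_≤ 1) eq (f≤1 x)))
  where
  rest : ∀ {y} → y ∈ xs → f y ≡ 0
  rest {y} y∈ with f y in eq′
  ... | zero  = refl
  ... | suc _ = contradiction (inj (here refl) (there y∈) (subst (1 ≤_) (sym eq) (s≤s z≤n))
                                                       (subst (1 ≤_) (sym eq′) (s≤s z≤n)))
                              (All.lookup x∉ y∈)

∑-single : ∀ (_≟_ : DecidableEquality A) {xs c} → Unique xs → c ∈ xs → ∀ (F : A → ℕ) →
           (∑[ x ← xs ] ⟦ c ≟ x ⟧ * F x) ≡ F c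
∑-single _≟_ {x ∷ xs} {c} (x∉ ∷ u) c∈ F with c ≟ x | c∈
... | yes refl | _ = trans (cong₂ _+_ (+-identityʳ (F c)) (∑-null xs (λ {y} y∈ →
      cong (_* F y) (⟦⟧-no (c ≟ y) (λ c≡y → contradiction c≡y (All.lookup x∉ y∈))))))
      (+-identityʳ (F c))
... | no c≢x | here c≡x  = contradiction c≡x c≢x
... | no _   | there c∈′ = ∑-single _≟_ u c∈′ F

∑-concatMap : ∀ (h : A → List B) xs F → ∑ (concatMap h xs) F ≡ (∑[ x ← xs ] ∑ (h x) F)
∑-concatMap h []       F = refl
∑-concatMap h (x ∷ xs) F = trans (∑-++ (h x) _ F) (cong (∑ (h x) F +_) (∑-concatMap h xs F))

∑-length : ∀ (xs : List A) → length xs ≡ (∑[ _ ← xs ] 1)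
∑-length xs = sym (trans (∑-const xs 1) (*-identityʳ (length xs)))

length-allFin : ∀ n → length (allFin n) ≡ n
length-allFin n = length-tabulate (λ i → i)

-- A number with quotient `q` is `j + q * δ` for a remainder `j` below δ, and each remainder
-- accounts for at most one entry of the list.
block-size : ∀ δ .{{_ : NonZero δ}} q D → (∑[ r ← downFrom D ] ⟦ r / δ ℕ.≟ q ⟧) ≤ δ
block-size δ q D = begin
  (∑[ r ← downFrom D ] ⟦ r / δ ℕ.≟ q ⟧)
    ≤⟨ ∑-mono (downFrom D) (λ {r} _ → witness r) ⟩
  (∑[ r ← downFrom D ] ∑[ j ← downFrom δ ] ⟦ r ℕ.≟ j + q * δ ⟧)
    ≡⟨ ∑-swap (downFrom D) (downFrom δ) _ ⟩
  (∑[ j ← downFrom δ ] ∑[ r ← downFrom D ] ⟦ r ℕ.≟ j + q * δ ⟧)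
    ≤⟨ ∑-mono (downFrom δ) (λ {j} _ → ∑-≤1 (downFrom⁺ D) (λ r → ⟦⟧≤1 (r ℕ.≟ j + q * δ))
         (λ {x} {y} _ _ px py → trans (⟦⟧-pos (x ℕ.≟ _) px) (sym (⟦⟧-pos (y ℕ.≟ _) py)))) ⟩
  (∑[ j ← downFrom δ ] 1)
    ≡⟨ trans (∑-const (downFrom δ) 1) (trans (*-identityʳ (length (downFrom δ))) (length-downFrom δ)) ⟩
  δ ∎
  where
  open ≤-Reasoning
  witness : ∀ r → ⟦ r / δ ℕ.≟ q ⟧ ≤ (∑[ j ← downFrom δ ] ⟦ r ℕ.≟ j + q * δ ⟧)
  witness r = ⟦⟧-≤ (r / δ ℕ.≟ q) λ where
    refl → ≤-trans (≤-reflexive (sym (⟦⟧-yes (r ℕ.≟ _) (m≡m%n+[m/n]*n r δ))))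
             (∑-∈ (λ j → ⟦ r ℕ.≟ j + (r / δ) * δ ⟧) (∈-downFrom⁺ (m%n<n r δ)))

-- Splitting vertices into classes of bounded out-degree

module Splitting {E P : Set} (_≟ᴱ_ : DecidableEquality E) (_≟ᴾ_ : DecidableEquality P) (src : E → P) where

  deg : List E → P → ℕ
  deg es p = ∑[ e ← es ] ⟦ src e ≟ᴾ p ⟧

  -- The position of `e` among the entries with the same source, counted from the end of the list;
  -- this order matches the recursion of `downFrom`.
  rank : List E → E → ℕ
  rank []       e = 0
  rank (x ∷ xs) e = if-same (x ≟ᴱ e)
    where
    if-same : Dec (x ≡ e) → ℕ
    if-same (yes _) = deg xs (src e)
    if-same (no _)  = rank xs e

  rank-head : ∀ x xs → rank (x ∷ xs) x ≡ deg xs (src x)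
  rank-head x xs with x ≟ᴱ x
  ... | yes _ = refl
  ... | no ¬p = contradiction refl ¬p

  rank-tail : ∀ {x e} xs → x ≢ e → rank (x ∷ xs) e ≡ rank xs e
  rank-tail {x} {e} xs x≢e with x ≟ᴱ e
  ... | yes x≡e = contradiction x≡e x≢e
  ... | no _    = refl

  -- The entries with source `p` have the ranks deg - 1, ..., 0, each once: a new head receives the
  -- next larger rank and leaves the others unchanged.
  ∑-rank : ∀ {es} → Unique es → ∀ p (G : ℕ → ℕ) →
           (∑[ e ← es ] ⟦ src e ≟ᴾ p ⟧ * G (rank es e)) ≡ ∑ (downFrom (deg es p)) G
  ∑-rank {[]}     _        p G = refl
  ∑-rank {x ∷ xs} (x∉ ∷ u) p G with ∑-rank u p G | src x ≟ᴾ p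
  ... | ih | yes refl = cong₂ _+_ (trans (+-identityʳ _) (cong G (rank-head x xs))) (trans tail ih)
    where tail = ∑-cong-∈ xs (λ {e} e∈ → cong (λ z → ⟦ src e ≟ᴾ src x ⟧ * G z) (rank-tail xs (All.lookup x∉ e∈)))
  ... | ih | no _     = trans tail ih
    where tail = ∑-cong-∈ xs (λ {e} e∈ → cong (λ z → ⟦ src e ≟ᴾ p ⟧ * G z) (rank-tail xs (All.lookup x∉ e∈)))

  rank≤deg : ∀ es e → rank es e ≤ deg es (src e)
  rank≤deg []       e = z≤n
  rank≤deg (x ∷ xs) e with x ≟ᴱ e
  ... | yes _ = m≤n+m _ _
  ... | no _  = ≤-trans (rank≤deg xs e) (m≤n+m _ _)

  module Classes (es : List E) (es! : Unique es) (ps : List P) (ps! : Unique ps) (ps-all : ∀ p → p ∈ ps)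
                 (δ : ℕ) .{{_ : NonZero δ}} where

    -- Thanks to the `suc`, a vertex without outgoing edges keeps a class as well, so there are at
    -- least as many classes as vertices.
    blocks : P → ℕ
    blocks p = suc (deg es p / δ)

    V : Set
    V = Σ P (λ p → Fin (blocks p))

    _≟_ : DecidableEquality V
    _≟_ = ≡-dec _≟ᴾ_ Fin._≟_

    𝕍 : List V
    𝕍 = concatMap (λ p → map (p ,_) (allFin (blocks p))) ps

    -- The `mod` never reduces anything, by `rank≤deg`; it only packs the block number into `Fin`.
    cls : E → V
    cls e = src e , (rank es e / δ) mod blocks (src e)

    ∑-𝕍 : ∀ F → ∑ 𝕍 F ≡ (∑[ p ← ps ] ∑[ q ← allFin (blocks p) ] F (p , q))
    ∑-𝕍 F = trans (∑-concatMap _ ps F) (∑-cong ps (λ p → ∑-map (p ,_) (allFin (blocks p)) F))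

    ∑-δ : ∀ c (F : V → ℕ) → (∑[ x ← 𝕍 ] ⟦ c ≟ x ⟧ * F x) ≡ F c
    ∑-δ (p₀ , q₀) F = begin
      (∑[ x ← 𝕍 ] ⟦ (p₀ , q₀) ≟ x ⟧ * F x)
        ≡⟨ ∑-𝕍 _ ⟩
      (∑[ p ← ps ] ∑[ q ← allFin (blocks p) ] ⟦ (p₀ , q₀) ≟ (p , q) ⟧ * F (p , q))
        ≡⟨ ∑-cong ps inner ⟩
      (∑[ p ← ps ] ⟦ p₀ ≟ᴾ p ⟧ * F (p₀ , q₀))
        ≡⟨ ∑-single _≟ᴾ_ ps! (ps-all p₀) (λ _ → F (p₀ , q₀)) ⟩
      F (p₀ , q₀) ∎
      where
      open ≡-Reasoning
      inner : ∀ p → (∑[ q ← allFin (blocks p) ] ⟦ (p₀ , q₀) ≟ (p , q) ⟧ * F (p , q)) ≡ ⟦ p₀ ≟ᴾ p ⟧ * F (p₀ , q₀)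
      inner p with p₀ ≟ᴾ p
      ... | no p₀≢p  = ∑-zero (allFin (blocks p))
      ... | yes refl = trans
        (∑-single Fin._≟_ (allFin⁺ (blocks p)) (∈-allFin q₀) (λ q → F (p , q)))
        (sym (+-identityʳ (F (p , q₀))))

    fibre-size : ∀ x → (∑[ e ← es ] ⟦ cls e ≟ x ⟧) ≤ δ
    fibre-size (p , q) = begin
      (∑[ e ← es ] ⟦ cls e ≟ (p , q) ⟧)
        ≤⟨ ∑-mono es (λ {e} _ → coarser e) ⟩
      (∑[ e ← es ] ⟦ src e ≟ᴾ p ⟧ * ⟦ rank es e / δ ℕ.≟ toℕ q ⟧)
        ≡⟨ ∑-rank es! p (λ r → ⟦ r / δ ℕ.≟ toℕ q ⟧) ⟩
      (∑[ r ← downFrom (deg es p) ] ⟦ r / δ ℕ.≟ toℕ q ⟧)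
        ≤⟨ block-size δ (toℕ q) (deg es p) ⟩
      δ ∎
      where
      open ≤-Reasoning
      same-block : ∀ e → toℕ (proj₂ (cls e)) ≡ rank es e / δ
      same-block e = trans (Fin.toℕ-fromℕ< _)
        (m<n⇒m%n≡m (s≤s (/-monoˡ-≤ δ (rank≤deg es e))))
      coarser : ∀ e → ⟦ cls e ≟ (p , q) ⟧ ≤ ⟦ src e ≟ᴾ p ⟧ * ⟦ rank es e / δ ℕ.≟ toℕ q ⟧
      coarser e = ⟦⟧-≤ (cls e ≟ (p , q)) λ where
        refl → ≤-reflexive (sym (cong₂ _*_ (⟦⟧-yes (src e ≟ᴾ src e) refl)
                 (⟦⟧-yes (rank es e / δ ℕ.≟ _) (sym (same-block e)))))

    ∑-deg : ∑ ps (deg es) ≡ length es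
    ∑-deg = trans (∑-swap ps es _) (trans (∑-cong es (λ e → trans
      (∑-cong ps (λ p → sym (*-identityʳ _))) (∑-single _≟ᴾ_ ps! (ps-all (src e)) (λ _ → 1))))
      (sym (∑-length es)))

    length-𝕍 : length 𝕍 ≡ ∑ ps blocks
    length-𝕍 = trans (∑-length 𝕍) (trans (∑-𝕍 (λ _ → 1)) (∑-cong ps (λ p →
      trans (sym (∑-length (allFin (blocks p)))) (length-allFin (blocks p)))))

    length-ps≤length-𝕍 : length ps ≤ length 𝕍
    length-ps≤length-𝕍 = subst₂ _≤_ (sym (∑-length ps)) (sym length-𝕍) (∑-mono ps (λ _ → s≤s z≤n))

    length-𝕍≤ : length 𝕍 * δ ≤ length ps * δ + length es
    length-𝕍≤ = begin
      length 𝕍 * δ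
        ≡⟨ trans (cong (_* δ) length-𝕍) (sym (∑-*ʳ ps blocks δ)) ⟩
      (∑[ p ← ps ] blocks p * δ)
        ≤⟨ ∑-mono ps (λ {p} _ → +-monoʳ-≤ δ (m/n*n≤m (deg es p) δ)) ⟩
      (∑[ p ← ps ] (δ + deg es p))
        ≡⟨ trans (∑-+ ps _ _) (cong₂ _+_ (∑-const ps δ) ∑-deg) ⟩
      length ps * δ + length es ∎
      where open ≤-Reasoning

∑-cartesianProduct : ∀ (xs : List A) (ys : List B) F →
  ∑ (cartesianProduct xs ys) F ≡ (∑[ x ← xs ] ∑[ y ← ys ] F (x , y))
∑-cartesianProduct []       ys F = refl
∑-cartesianProduct (x ∷ xs) ys F = trans (∑-++ (map (x ,_) ys) _ F)
  (cong₂ _+_ (∑-map (x ,_) ys F) (∑-cartesianProduct xs ys F))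

⟦⟧-pos² : {P Q : Set} (d : Dec P) (d′ : Dec Q) → 1 ≤ ⟦ d ⟧ * ⟦ d′ ⟧ → P × Q
⟦⟧-pos² (yes p) (yes q) _ = p , q

-- Double counting over the pairs with `f x ≡ y`: each `y` of the list is reached exactly once, from
-- `f y`.
∑-involution : DecidableEquality A → ∀ {xs : List A} → Unique xs → (f : A → A) → (∀ x → f (f x) ≡ x) →
               (∀ {x} → x ∈ xs → f x ∈ xs) → ∀ F → ∑ xs (F ∘ f) ≡ ∑ xs F
∑-involution _≟_ {xs} xs! f f∘f f∈ F = begin
  ∑ xs (F ∘ f)
    ≡⟨ ∑-cong-∈ xs (λ {x} x∈ → sym (∑-single _≟_ xs! (f∈ x∈) F)) ⟩
  (∑[ x ← xs ] ∑[ y ← xs ] ⟦ f x ≟ y ⟧ * F y)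
    ≡⟨ trans (∑-swap xs xs _) (∑-cong xs (λ y → ∑-*ʳ xs (λ x → ⟦ f x ≟ y ⟧) (F y))) ⟩
  (∑[ y ← xs ] (∑[ x ← xs ] ⟦ f x ≟ y ⟧) * F y)
    ≡⟨ ∑-cong-∈ xs (λ {y} y∈ → trans (cong (_* F y) (once y∈)) (+-identityʳ (F y))) ⟩
  ∑ xs F ∎
  where
  open ≡-Reasoning
  once : ∀ {y} → y ∈ xs → (∑[ x ← xs ] ⟦ f x ≟ y ⟧) ≡ 1
  once {y} y∈ = trans
    (∑-cong xs (λ x → trans
      (⟦⟧-cong (f x ≟ y) (f y ≟ x) (λ { refl → f∘f x }) (λ { refl → f∘f y }))
      (sym (*-identityʳ _))))
    (∑-single _≟_ xs! (f∈ y∈) (λ _ → 1))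

AllPairs-lookup : ∀ {R : A → A → Set} → (∀ {x y} → R x y → R y x) → ∀ {xs} → AllPairs R xs →
                  ∀ {i j} → i ≢ j → R (lookup xs i) (lookup xs j)
AllPairs-lookup R-sym (x∼ ∷ ps) {zero}  {zero}  i≢j = contradiction refl i≢j
AllPairs-lookup R-sym (x∼ ∷ ps) {zero}  {suc j} i≢j = All.lookup x∼ (∈-lookup j)
AllPairs-lookup R-sym (x∼ ∷ ps) {suc i} {zero}  i≢j = R-sym (All.lookup x∼ (∈-lookup i))
AllPairs-lookup R-sym (x∼ ∷ ps) {suc i} {suc j} i≢j = AllPairs-lookup R-sym ps (i≢j ∘ cong suc)

-- Sizes of finite subsets

elements : Subset k → List (Fin k)
elements []            = []
elements (inside ∷ p)  = zero ∷ map suc (elements p)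
elements (outside ∷ p) = map suc (elements p)

length-elements : (p : Subset k) → length (elements p) ≡ ∣ p ∣
length-elements []            = refl
length-elements (inside ∷ p)  = cong suc (trans (length-map suc (elements p)) (length-elements p))
length-elements (outside ∷ p) = trans (length-map suc (elements p)) (length-elements p)

elements-∈ : (p : Subset k) → All (_∈ˢ p) (elements p)
elements-∈ []            = []
elements-∈ (inside ∷ p)  = here ∷ All.map⁺ (All.map there (elements-∈ p))
elements-∈ (outside ∷ p) = All.map⁺ (All.map there (elements-∈ p))

elements-! : (p : Subset k) → Unique (elements p)
elements-! []            = []
elements-! (inside ∷ p)  = All.map⁺ (All.universal (λ _ ()) (elements p)) ∷ map⁺ Fin.suc-injective (elements-! p)
elements-! (outside ∷ p) = map⁺ Fin.suc-injective (elements-! p)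

unique⇒length≤∣∣ : ∀ {xs : List (Fin k)} {p : Subset k} → Unique xs → All (_∈ˢ p) xs → length xs ≤ ∣ p ∣
unique⇒length≤∣∣ {xs = []}     _        _         = z≤n
unique⇒length≤∣∣ {xs = x ∷ xs} (x∉ ∷ u) (x∈ ∷ xs∈) = ≤-trans
  (s≤s (unique⇒length≤∣∣ u (All.zipWith (λ (x≢y , y∈) → x∈p∧x≢y⇒x∈p-y y∈ (≢-sym x≢y)) (x∉ , xs∈))))
  (x∈p⇒∣p-x∣<∣p∣ x∈)

∣⁅x⁆∪p∣≤ : ∀ (x : Fin k) p → ∣ ⁅ x ⁆ ∪ p ∣ ≤ suc ∣ p ∣
∣⁅x⁆∪p∣≤ zero    (b ∷ p)       = s≤s (≤-trans (p⊆q⇒∣p∣≤∣q∣ {p = ∅ ∪ p} (λ i∈ →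
  [ (λ i∈∅ → contradiction i∈∅ ∉⊥) , (λ i∈p → i∈p) ]′ (x∈p∪q⁻ ∅ p i∈))) (∣p∣≤∣x∷p∣ b p))
∣⁅x⁆∪p∣≤ (suc x) (inside ∷ p)  = s≤s (∣⁅x⁆∪p∣≤ x p)
∣⁅x⁆∪p∣≤ (suc x) (outside ∷ p) = ∣⁅x⁆∪p∣≤ x p

∣pair∣≡2 : ∀ {p : Subset k} {x y} → x ∈ˢ p → y ∈ˢ p → x ≢ y → (∀ {i} → i ∈ˢ p → i ≡ x ⊎ i ≡ y) → ∣ p ∣ ≡ 2
∣pair∣≡2 {p = p} {x} {y} x∈ y∈ x≢y only = ≤-antisym
  (≤-trans (p⊆q⇒∣p∣≤∣q∣ {q = ⁅ x ⁆ ∪ ⁅ y ⁆} (λ i∈ → x∈p∪q⁺ (case-⊎ (only i∈))))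
    (≤-trans (∣⁅x⁆∪p∣≤ x ⁅ y ⁆) (s≤s (≤-reflexive (∣⁅x⁆∣≡1 y)))))
  (unique⇒length≤∣∣ ((x≢y ∷ []) ∷ [] ∷ []) (x∈ ∷ y∈ ∷ []))
  where
  case-⊎ : ∀ {i} → i ≡ x ⊎ i ≡ y → i ∈ˢ ⁅ x ⁆ ⊎ i ∈ˢ ⁅ y ⁆
  case-⊎ (inj₁ refl) = inj₁ (x∈⁅x⁆ x)
  case-⊎ (inj₂ refl) = inj₂ (x∈⁅x⁆ y)

∣empty∣≡0 : ∀ {p : Subset k} → (∀ {i} → ¬ i ∈ˢ p) → ∣ p ∣ ≡ 0
∣empty∣≡0 {k = k} {p} none = n≤0⇒n≡0 (≤-trans (p⊆q⇒∣p∣≤∣q∣ {q = ∅} (λ i∈ → contradiction i∈ none))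
                                           (≤-reflexive (∣⊥∣≡0 k)))

-- Flags, darts and their conflicts

module Darts {n m : ℕ} (H : Hypergraph3 n m) (linear : Linear H) where

  -- To be read as an edge with an ordering of its three vertices. The conditions are kept apart in
  -- `IsFlag`, so that equality of flags is decidable and compares only the data.
  Flag : Set
  Flag = Fin m × Fin n × Fin n × Fin n

  hy : Flag → Fin m
  hy = proj₁

  tail head apex : Flag → Fin n
  tail φ = proj₁ (proj₂ φ)
  head φ = proj₁ (proj₂ (proj₂ φ))
  apex φ = proj₂ (proj₂ (proj₂ φ))

  _≟ᶠ_ : DecidableEquality Flag
  _≟ᶠ_ = ≡-dec Fin._≟_ (≡-dec Fin._≟_ (≡-dec Fin._≟_ Fin._≟_))

  record IsFlag (φ : Flag) : Set where
    constructor isFlag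
    field
      tail∈     : tail φ ∈ˢ edge H (hy φ)
      head∈     : head φ ∈ˢ edge H (hy φ)
      apex∈     : apex φ ∈ˢ edge H (hy φ)
      tail≢head : tail φ ≢ head φ
      tail≢apex : tail φ ≢ apex φ
      head≢apex : head φ ≢ apex φ
  open IsFlag

  isFlag? : ∀ φ → Dec (IsFlag φ)
  isFlag? φ = map′
    (λ (p , q , r , s , t , u) → isFlag p q r s t u)
    (λ (isFlag p q r s t u) → p , q , r , s , t , u)
    ((tail φ ∈? edge H (hy φ)) ×-dec (head φ ∈? edge H (hy φ)) ×-dec (apex φ ∈? edge H (hy φ)) ×-dec
     ¬? (tail φ Fin.≟ head φ) ×-dec ¬? (tail φ Fin.≟ apex φ) ×-dec ¬? (head φ Fin.≟ apex φ))

  -- The form in which linearity enters: two common vertices of distinct edges would exceed the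
  -- allowed intersection.
  pair-in-one-edge : ∀ {i j x y} → x ≢ y → x ∈ˢ edge H i → y ∈ˢ edge H i → x ∈ˢ edge H j → y ∈ˢ edge H j → i ≡ j
  pair-in-one-edge {i} {j} {x} {y} x≢y xi yi xj yj with i Fin.≟ j
  ... | yes i≡j = i≡j
  ... | no  i≢j = contradiction
    (≤-trans (unique⇒length≤∣∣ ((x≢y ∷ []) ∷ [] ∷ []) (x∈p∩q⁺ (xi , xj) ∷ x∈p∩q⁺ (yi , yj) ∷ [])) (linear i j i≢j))
    λ { (s≤s ()) }

  flag-covers : ∀ {φ x} → IsFlag φ → x ∈ˢ edge H (hy φ) → x ≡ tail φ ⊎ x ≡ head φ ⊎ x ≡ apex φ
  flag-covers {φ} {x} F x∈ with x Fin.≟ tail φ | x Fin.≟ head φ | x Fin.≟ apex φ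
  ... | yes p | _     | _     = inj₁ p
  ... | no _  | yes p | _     = inj₂ (inj₁ p)
  ... | no _  | no _  | yes p = inj₂ (inj₂ p)
  ... | no p  | no q  | no r  = contradiction
    (≤-trans (unique⇒length≤∣∣ ((p ∷ q ∷ r ∷ []) ∷ (tail≢head F ∷ tail≢apex F ∷ []) ∷ (head≢apex F ∷ []) ∷ [] ∷ [])
                               (x∈ ∷ tail∈ F ∷ head∈ F ∷ apex∈ F ∷ []))
             (≤-reflexive (uniform H (hy φ))))
    λ { (s≤s (s≤s (s≤s ()))) }

  flag-≡ : ∀ {φ ψ : Flag} → hy φ ≡ hy ψ → tail φ ≡ tail ψ → head φ ≡ head ψ → apex φ ≡ apex ψ → φ ≡ ψ
  flag-≡ refl refl refl refl = refl

  tail-head-determine : ∀ {φ ψ} → IsFlag φ → IsFlag ψ → tail φ ≡ tail ψ → head φ ≡ head ψ → φ ≡ ψ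
  tail-head-determine {φ} {ψ} F G refl refl
    with refl ← pair-in-one-edge (tail≢head F) (tail∈ F) (head∈ F) (tail∈ G) (head∈ G)
    with flag-covers F (apex∈ G)
  ... | inj₁ p        = contradiction (sym p) (tail≢apex G)
  ... | inj₂ (inj₁ p) = contradiction (sym p) (head≢apex G)
  ... | inj₂ (inj₂ p) = flag-≡ refl refl refl (sym p)

  tail-apex-determine : ∀ {φ ψ} → IsFlag φ → IsFlag ψ → tail φ ≡ tail ψ → apex φ ≡ apex ψ → φ ≡ ψ
  tail-apex-determine {φ} {ψ} F G refl refl
    with refl ← pair-in-one-edge (tail≢apex F) (tail∈ F) (apex∈ F) (tail∈ G) (apex∈ G)
    with flag-covers F (head∈ G)
  ... | inj₁ p        = contradiction (sym p) (tail≢head G)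
  ... | inj₂ (inj₁ p) = flag-≡ refl refl (sym p) refl
  ... | inj₂ (inj₂ p) = contradiction p (head≢apex G)

  swap : Flag → Flag
  swap (i , a , b , z) = i , b , a , z

  swap-isFlag : ∀ {φ} → IsFlag φ → IsFlag (swap φ)
  swap-isFlag F = isFlag (head∈ F) (tail∈ F) (apex∈ F) (≢-sym (tail≢head F)) (head≢apex F) (tail≢apex F)

  allFlags flags : List Flag
  allFlags = cartesianProduct (allFin m) (cartesianProduct (allFin n) (cartesianProduct (allFin n) (allFin n)))
  flags    = filter isFlag? allFlags

  flags! : Unique flags
  flags! = filter⁺ isFlag? (cartesianProduct⁺ (allFin⁺ m)
             (cartesianProduct⁺ (allFin⁺ n) (cartesianProduct⁺ (allFin⁺ n) (allFin⁺ n))))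

  ∈-flags⁺ : ∀ {φ} → IsFlag φ → φ ∈ flags
  ∈-flags⁺ = ∈-filter⁺ isFlag? (∈-cartesianProduct⁺ (∈-allFin _)
    (∈-cartesianProduct⁺ (∈-allFin _) (∈-cartesianProduct⁺ (∈-allFin _) (∈-allFin _))))

  ∈-flags⁻ : ∀ {φ} → φ ∈ flags → IsFlag φ
  ∈-flags⁻ φ∈ = proj₂ (∈-filter⁻ isFlag? {xs = allFlags} φ∈)

  -- A dart (φ , ψ) is an edge of the auxiliary graph, directed from (tail φ , tail ψ) to (head φ , head ψ)
  Dart : Set
  Dart = Flag × Flag

  record IsDart (e : Dart) : Set where
    constructor isDart
    field
      first     : IsFlag (proj₁ e)
      second    : IsFlag (proj₂ e)
      same-apex : apex (proj₁ e) ≡ apex (proj₂ e)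
      hy≢hy     : hy (proj₁ e) ≢ hy (proj₂ e)
  open IsDart

  _≟ᵈ_ : DecidableEquality Dart
  _≟ᵈ_ = ≡-dec _≟ᶠ_ _≟ᶠ_

  compatible? : ∀ (e : Dart) → Dec (apex (proj₁ e) ≡ apex (proj₂ e) × hy (proj₁ e) ≢ hy (proj₂ e))
  compatible? (φ , ψ) = (apex φ Fin.≟ apex ψ) ×-dec ¬? (hy φ Fin.≟ hy ψ)

  darts : List Dart
  darts = filter compatible? (cartesianProduct flags flags)

  darts! : Unique darts
  darts! = filter⁺ compatible? (cartesianProduct⁺ flags! flags!)

  ∈-darts⁺ : ∀ {e} → IsDart e → e ∈ darts
  ∈-darts⁺ (isDart F G z h) = ∈-filter⁺ compatible? (∈-cartesianProduct⁺ (∈-flags⁺ F) (∈-flags⁺ G)) (z , h)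

  ∈-darts⁻ : ∀ {e} → e ∈ darts → IsDart e
  ∈-darts⁻ e∈ with ∈-filter⁻ compatible? {xs = cartesianProduct flags flags} e∈
  ... | e∈′ , z , h with ∈-cartesianProduct⁻ flags flags e∈′
  ...   | φ∈ , ψ∈ = isDart (∈-flags⁻ φ∈) (∈-flags⁻ ψ∈) z h

  rev : Dart → Dart
  rev (φ , ψ) = swap φ , swap ψ

  rev-∈ : ∀ {e} → e ∈ darts → rev e ∈ darts
  rev-∈ e∈ with ∈-darts⁻ e∈
  ... | isDart F G z h = ∈-darts⁺ (isDart (swap-isFlag F) (swap-isFlag G) z h)

  ∑-rev : ∀ F → ∑ darts (F ∘ rev) ≡ ∑ darts F
  ∑-rev = ∑-involution _≟ᵈ_ darts! rev (λ _ → refl) rev-∈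

  -- A walk of darts consists of two parallel walks of flags, the strands. Consecutive flags of a
  -- strand meet in a head and a tail, and the two flags of a dart meet in their apex.
  data Strand : Set where
    one two : Strand

  -- Tails are left out on purpose: along a closed walk each tail is a head of the preceding dart,
  -- so the slots name every vertex of the cycle, and in a conflict-free cycle only once.
  data Slot : Set where
    end : Strand → Slot
    top : Slot

  flag : Dart → Strand → Flag
  flag e one = proj₁ e
  flag e two = proj₂ e

  flag-isFlag : ∀ {e} → IsDart e → ∀ σ → IsFlag (flag e σ)
  flag-isFlag d one = first d
  flag-isFlag d two = second d

  slot : Slot → Dart → Fin n
  slot (end σ) e = head (flag e σ)
  slot top     e = apex (proj₁ e)

  apex-slot : ∀ {e} → IsDart e → ∀ σ → apex (flag e σ) ≡ slot top e
  apex-slot d one = refl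
  apex-slot d two = sym (same-apex d)

  head≢head : ∀ {e} → IsDart e → head (proj₁ e) ≢ head (proj₂ e)
  head≢head {φ , ψ} (isDart F G z h) eq = h (pair-in-one-edge (head≢apex F) (head∈ F) (apex∈ F)
    (subst (_∈ˢ edge H (hy ψ)) (sym eq) (head∈ G)) (subst (_∈ˢ edge H (hy ψ)) (sym z) (apex∈ G)))

  end≢top : ∀ {e} → IsDart e → ∀ σ → slot (end σ) e ≢ slot top e
  end≢top d σ eq = head≢apex (flag-isFlag d σ) (trans eq (sym (apex-slot d σ)))

  slot-injective : ∀ {e} → IsDart e → ∀ j k → slot j e ≡ slot k e → j ≡ k
  slot-injective d (end one) (end one) eq = refl
  slot-injective d (end one) (end two) eq = contradiction eq (head≢head d)
  slot-injective d (end two) (end one) eq = contradiction (sym eq) (head≢head d)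
  slot-injective d (end two) (end two) eq = refl
  slot-injective d (end σ)   top       eq = contradiction eq (end≢top d σ)
  slot-injective d top       (end σ)   eq = contradiction (sym eq) (end≢top d σ)
  slot-injective d top       top       eq = refl

  src : Dart → Fin n × Fin n
  src (φ , ψ) = tail φ , tail ψ

  -- With its tail known, one further vertex in a known role fixes a flag, by linearity. That flag
  -- fixes the common apex, and the apex together with the other tail fixes the other flag.
  src-slot-determine : ∀ {e f} → IsDart e → IsDart f → src e ≡ src f → ∀ j → slot j e ≡ slot j f → e ≡ f
  src-slot-determine {φ , ψ} {φ′ , ψ′} d d′ src≡ (end one) eq
    with refl ← tail-head-determine (first d) (first d′) (cong proj₁ src≡) eq =
    cong (φ ,_) (tail-apex-determine (second d) (second d′) (cong proj₂ src≡)
                  (trans (sym (same-apex d)) (same-apex d′)))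
  src-slot-determine {φ , ψ} {φ′ , ψ′} d d′ src≡ (end two) eq
    with refl ← tail-head-determine (second d) (second d′) (cong proj₂ src≡) eq =
    cong (_, ψ) (tail-apex-determine (first d) (first d′) (cong proj₁ src≡)
                  (trans (same-apex d) (sym (same-apex d′))))
  src-slot-determine {φ , ψ} {φ′ , ψ′} d d′ src≡ top eq =
    cong₂ _,_ (tail-apex-determine (first d) (first d′) (cong proj₁ src≡) eq)
              (tail-apex-determine (second d) (second d′) (cong proj₂ src≡)
                (trans (sym (same-apex d)) (trans eq (same-apex d′))))

  slots : List Slot
  slots = end one ∷ end two ∷ top ∷ []

  ∈-slots : ∀ j → j ∈ slots
  ∈-slots (end one) = here refl
  ∈-slots (end two) = there (here refl)
  ∈-slots top       = there (there (here refl))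

  χ : Dart → Dart → ℕ
  χ e f = ∑[ j ← slots ] ∑[ k ← slots ] ⟦ slot j e Fin.≟ slot k f ⟧

  χ-sym : ∀ e f → χ e f ≡ χ f e
  χ-sym e f = trans (∑-swap slots slots (λ j k → ⟦ slot j e Fin.≟ slot k f ⟧)) (∑-cong slots (λ k → ∑-cong slots (λ j →
    ⟦⟧-cong (slot j e Fin.≟ slot k f) (slot k f Fin.≟ slot j e) sym sym)))

  χ≤9 : ∀ e f → χ e f ≤ 9
  χ≤9 e f = ∑-mono slots {g = λ _ → ∑[ _ ← slots ] 1} (λ {j} _ → ∑-mono slots (λ {k} _ → ⟦⟧≤1 (slot j e Fin.≟ slot k f)))

  χ≡0⇒disjoint : ∀ {e f} → χ e f ≡ 0 → ∀ j k → slot j e ≢ slot k f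
  χ≡0⇒disjoint {e} {f} χ≡0 j k eq = contradiction
    (≤-trans (≤-reflexive (sym (⟦⟧-yes (slot j e Fin.≟ slot k f) eq)))
      (≤-trans (∑-∈ (λ k → ⟦ slot j e Fin.≟ slot k f ⟧) (∈-slots k))
        (≤-trans (∑-∈ (λ j → ∑[ k ← slots ] ⟦ slot j e Fin.≟ slot k f ⟧) (∈-slots j)) (≤-reflexive χ≡0))))
    λ ()

  -- For each of the 3 × 3 pairs of slots at most one dart of the class qualifies, by
  -- `src-slot-determine`. Only the source of a dart matters for this, so any refinement of the
  -- sources is allowed.
  few-conflicts : ∀ {V : Set} (_≟_ : DecidableEquality V) (cls : Dart → V) →
                  (∀ {e f} → cls e ≡ cls f → src e ≡ src f) →
                  ∀ x f → (∑[ e ← darts ] ⟦ cls e ≟ x ⟧ * χ e f) ≤ 9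
  few-conflicts _≟_ cls refines x f = begin
    (∑[ e ← darts ] ⟦ cls e ≟ x ⟧ * χ e f)
      ≡⟨ ∑-cong darts (λ e → trans
           (sym (∑-*ˡ slots ⟦ cls e ≟ x ⟧ (λ j → ∑[ k ← slots ] ⟦ slot j e Fin.≟ slot k f ⟧)))
           (∑-cong slots (λ j → sym (∑-*ˡ slots ⟦ cls e ≟ x ⟧ (λ k → ⟦ slot j e Fin.≟ slot k f ⟧))))) ⟩
    (∑[ e ← darts ] ∑[ j ← slots ] ∑[ k ← slots ] G e j k)
      ≡⟨ trans (∑-swap darts slots (λ e j → ∑[ k ← slots ] G e j k))
               (∑-cong slots (λ j → ∑-swap darts slots (λ e k → G e j k))) ⟩
    (∑[ j ← slots ] ∑[ k ← slots ] ∑[ e ← darts ] G e j k)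
      ≤⟨ ∑-mono slots {g = λ _ → ∑[ _ ← slots ] 1} (λ {j} _ → ∑-mono slots (λ {k} _ → ∑-≤1 darts!
           (λ e → *-mono-≤ (⟦⟧≤1 (cls e ≟ x)) (⟦⟧≤1 (slot j e Fin.≟ slot k f))) (unique j k))) ⟩
    9 ∎
    where
    open ≤-Reasoning
    G : Dart → Slot → Slot → ℕ
    G e j k = ⟦ cls e ≟ x ⟧ * ⟦ slot j e Fin.≟ slot k f ⟧
    unique : ∀ j k {e e′} → e ∈ darts → e′ ∈ darts → 1 ≤ G e j k → 1 ≤ G e′ j k → e ≡ e′
    unique j k {e} {e′} e∈ e′∈ p p′
      with ⟦⟧-pos² (cls e ≟ x) (slot j e Fin.≟ slot k f) p
         | ⟦⟧-pos² (cls e′ ≟ x) (slot j e′ Fin.≟ slot k f) p′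
    ... | c , s | c′ , s′ = src-slot-determine (∈-darts⁻ e∈) (∈-darts⁻ e′∈) (refines (trans c (sym c′)))
                              j (trans s (sym s′))

-- From conflict-free closed walks to 2-regular subhypergraphs

module Cycle {n m : ℕ} (H : Hypergraph3 n m) (linear : Linear H) where
  open Darts H linear
  open IsFlag
  open IsDart

  edges-of : List Dart → Subset m
  edges-of []      = ∅
  edges-of (e ∷ v) = ⁅ hy (flag e one) ⁆ ∪ (⁅ hy (flag e two) ⁆ ∪ edges-of v)

  ∣edges-of∣≤ : ∀ v → ∣ edges-of v ∣ ≤ 2 * length v
  ∣edges-of∣≤ []      = ≤-reflexive (∣⊥∣≡0 m)
  ∣edges-of∣≤ (e ∷ v) = begin
    ∣ edges-of (e ∷ v) ∣        ≤⟨ ∣⁅x⁆∪p∣≤ (hy (flag e one)) _ ⟩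
    suc ∣ ⁅ hy (flag e two) ⁆ ∪ edges-of v ∣ ≤⟨ s≤s (∣⁅x⁆∪p∣≤ (hy (flag e two)) _) ⟩
    suc (suc ∣ edges-of v ∣)    ≤⟨ s≤s (s≤s (∣edges-of∣≤ v)) ⟩
    2 + 2 * length v            ≡⟨ sym (*-suc 2 (length v)) ⟩
    2 * suc (length v) ∎
    where open ≤-Reasoning

  edges-of⁺ : ∀ v j σ → hy (flag (lookup v j) σ) ∈ˢ edges-of v
  edges-of⁺ (e ∷ v) zero    one = x∈p∪q⁺ (inj₁ (x∈⁅x⁆ _))
  edges-of⁺ (e ∷ v) zero    two = x∈p∪q⁺ (inj₂ (x∈p∪q⁺ (inj₁ (x∈⁅x⁆ _))))
  edges-of⁺ (e ∷ v) (suc j) σ   = x∈p∪q⁺ (inj₂ (x∈p∪q⁺ (inj₂ (edges-of⁺ v j σ))))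

  edges-of⁻ : ∀ v {i} → i ∈ˢ edges-of v → ∃[ j ] ∃[ σ ] i ≡ hy (flag (lookup v j) σ)
  edges-of⁻ []      i∈ = contradiction i∈ ∉⊥
  edges-of⁻ (e ∷ v) i∈ with x∈p∪q⁻ ⁅ hy (flag e one) ⁆ _ i∈
  ... | inj₁ i∈′ = zero , one , x∈⁅y⁆⇒x≡y _ i∈′
  ... | inj₂ i∈′ with x∈p∪q⁻ ⁅ hy (flag e two) ⁆ _ i∈′
  ...   | inj₁ i∈″ = zero , two , x∈⁅y⁆⇒x≡y _ i∈″
  ...   | inj₂ i∈″ with edges-of⁻ v i∈″
  ...     | j , σ , eq = suc j , σ , eq

  -- The same `tabulate` as in `degIn`, so that the sizes computed below are degrees by definition.
  incident : Fin n → Subset m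
  incident u = tabulate (λ i → Vec.lookup (edge H i) u)

  ∈-incident⁺ : ∀ {u i} → u ∈ˢ edge H i → i ∈ˢ incident u
  ∈-incident⁺ {u} {i} u∈ = lookup⇒[]= i (incident u)
    (trans (lookup∘tabulate _ i) ([]=⇒lookup u∈))

  ∈-incident⁻ : ∀ {u i} → i ∈ˢ incident u → u ∈ˢ edge H i
  ∈-incident⁻ {u} {i} i∈ = lookup⇒[]= u (edge H i)
    (trans (sym (lookup∘tabulate _ i)) ([]=⇒lookup i∈))

  tail-link : ∀ {e f} → src e ≡ src (rev f) → ∀ σ → tail (flag e σ) ≡ head (flag f σ)
  tail-link eq one = cong proj₁ eq
  tail-link eq two = cong proj₂ eq

  -- Each vertex of the cycle is a slot of exactly one dart. A top lies in the two edges of its dart,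
  -- and an end lies in one edge of its dart and in one edge of the next dart.
  cycle⇒TwoRegularSub : ∀ e v → All (_∈ darts) (e ∷ v) → AllPairs (λ e f → χ e f ≡ 0) (e ∷ v) →
    (∀ i → src (lookup (e ∷ v) i) ≡ src (rev (lookup (e ∷ v) (prev i)))) →
    TwoRegularSub H (edges-of (e ∷ v))
  cycle⇒TwoRegularSub e v v∈ free links = (_ , edges-of⁺ (e ∷ v) zero one) , degree
    where
    Ix = Fin (suc (length v))
    at : Ix → Dart
    at = lookup (e ∷ v)
    d : ∀ i → IsDart (at i)
    d i = ∈-darts⁻ (All.lookup v∈ (∈-lookup i))
    X : Fin n → Subset m
    X u = edges-of (e ∷ v) ∩ incident u
    hyp : Ix → Strand → Fin m
    hyp i σ = hy (flag (at i) σ)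

    link : ∀ i σ → tail (flag (at i) σ) ≡ slot (end σ) (at (prev i))
    link i = tail-link (links i)

    slot-unique : ∀ i j a b → slot a (at i) ≡ slot b (at j) → i ≡ j × a ≡ b
    slot-unique i j a b eq with i Fin.≟ j
    ... | yes refl = refl , slot-injective (d i) a b eq
    ... | no  i≢j  = contradiction eq
      (χ≡0⇒disjoint (AllPairs-lookup {R = λ e f → χ e f ≡ 0} (λ {e} {f} p → trans (χ-sym f e) p) free i≢j) a b)

    covers : ∀ {u} i σ → u ∈ˢ edge H (hyp i σ) →
             u ≡ slot (end σ) (at (prev i)) ⊎ u ≡ slot (end σ) (at i) ⊎ u ≡ slot top (at i)
    covers i σ u∈ with flag-covers (flag-isFlag (d i) σ) u∈
    ... | inj₁ p        = inj₁ (trans p (link i σ))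
    ... | inj₂ (inj₁ p) = inj₂ (inj₁ p)
    ... | inj₂ (inj₂ p) = inj₂ (inj₂ (trans p (apex-slot (d i) σ)))

    end∈ : ∀ i σ → slot (end σ) (at i) ∈ˢ edge H (hyp i σ)
    end∈ i σ = head∈ (flag-isFlag (d i) σ)

    top∈ : ∀ i σ → slot top (at i) ∈ˢ edge H (hyp i σ)
    top∈ i σ = subst (_∈ˢ edge H (hyp i σ)) (apex-slot (d i) σ) (apex∈ (flag-isFlag (d i) σ))

    end∈next : ∀ i σ → slot (end σ) (at (prev i)) ∈ˢ edge H (hyp i σ)
    end∈next i σ = subst (_∈ˢ edge H (hyp i σ)) (link i σ) (tail∈ (flag-isFlag (d i) σ))

    -- Only a walk of a single dart could have `prev i ≡ i`, and then a flag would have equal tail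
    -- and head.
    prev≢ : ∀ i → prev i ≢ i
    prev≢ i eq = tail≢head (flag-isFlag (d i) one) (trans (link i one) (cong (slot (end one) ∘ at) eq))

    ∈X⁺ : ∀ {u} i σ → u ∈ˢ edge H (hyp i σ) → hyp i σ ∈ˢ X u
    ∈X⁺ i σ u∈ = x∈p∩q⁺ (edges-of⁺ (e ∷ v) i σ , ∈-incident⁺ u∈)

    ∈X⁻ : ∀ {u x} → x ∈ˢ X u → ∃[ i ] ∃[ σ ] (x ≡ hyp i σ × u ∈ˢ edge H (hyp i σ))
    ∈X⁻ {u} x∈ with x∈p∩q⁻ (edges-of (e ∷ v)) (incident u) x∈
    ... | x∈S , x∈I with edges-of⁻ (e ∷ v) x∈S
    ...   | i , σ , refl = i , σ , refl , ∈-incident⁻ x∈I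

    top-degree : ∀ i → ∣ X (slot top (at i)) ∣ ≡ 2
    top-degree i = ∣pair∣≡2 (∈X⁺ i one (top∈ i one)) (∈X⁺ i two (top∈ i two)) (hy≢hy (d i)) only
      where
      only : ∀ {x} → x ∈ˢ X (slot top (at i)) → x ≡ hyp i one ⊎ x ≡ hyp i two
      only x∈ with ∈X⁻ x∈
      ... | j , σ , refl , u∈ with covers j σ u∈
      ...   | inj₁ p        = contradiction (proj₂ (slot-unique i (prev j) top (end σ) p)) λ ()
      ...   | inj₂ (inj₁ p) = contradiction (proj₂ (slot-unique i j top (end σ) p)) λ ()
      ...   | inj₂ (inj₂ p) with refl ← proj₁ (slot-unique i j top top p) with σ
      ...     | one = inj₁ refl
      ...     | two = inj₂ refl

    end-degree : ∀ i σ → ∣ X (slot (end σ) (at (prev i))) ∣ ≡ 2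
    end-degree i σ = ∣pair∣≡2 (∈X⁺ (prev i) σ (end∈ (prev i) σ)) (∈X⁺ i σ (end∈next i σ)) differ only
      where
      -- If the two edges agreed, the top of the preceding dart would lie in an edge of dart `i` and
      -- thus coincide with one of the slots there, against the uniqueness of slots.
      differ : hyp (prev i) σ ≢ hyp i σ
      differ eq with covers i σ (subst (λ h → slot top (at (prev i)) ∈ˢ edge H h) eq (top∈ (prev i) σ))
      ... | inj₁ p        = contradiction (proj₂ (slot-unique (prev i) (prev i) top (end σ) p)) λ ()
      ... | inj₂ (inj₁ p) = contradiction (proj₂ (slot-unique (prev i) i top (end σ) p)) λ ()
      ... | inj₂ (inj₂ p) = prev≢ i (proj₁ (slot-unique (prev i) i top top p))
      only : ∀ {x} → x ∈ˢ X (slot (end σ) (at (prev i))) → x ≡ hyp (prev i) σ ⊎ x ≡ hyp i σ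
      only x∈ with ∈X⁻ x∈
      ... | j , τ , refl , u∈ with covers j τ u∈
      ...   | inj₁ p with slot-unique (prev i) (prev j) (end σ) (end τ) p
      ...     | q , refl = inj₂ (cong (λ l → hyp l σ) {j} {i} (sym (prev-injective q)))
      only x∈ | j , τ , refl , u∈ | inj₂ (inj₁ p) with slot-unique (prev i) j (end σ) (end τ) p
      ...     | q , refl = inj₁ (cong (λ i → hyp i σ) (sym q))
      only x∈ | j , τ , refl , u∈ | inj₂ (inj₂ p) = contradiction (proj₂ (slot-unique (prev i) j (end σ) top p)) λ ()

    slot-degree : ∀ i a → ∣ X (slot a (at i)) ∣ ≡ 2
    slot-degree i top     = top-degree i
    slot-degree i (end σ) with prev-surjective i
    ... | j , refl = end-degree j σ

    covered? : ∀ u → Dec (∃[ i ] ∃[ σ ] u ∈ˢ edge H (hyp i σ))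
    covered? u with Fin.any? (λ i → (u ∈? edge H (hyp i one)) ⊎-dec (u ∈? edge H (hyp i two)))
    ... | yes (i , inj₁ u∈) = yes (i , one , u∈)
    ... | yes (i , inj₂ u∈) = yes (i , two , u∈)
    ... | no none = no λ { (i , one , u∈) → none (i , inj₁ u∈) ; (i , two , u∈) → none (i , inj₂ u∈) }

    degree : ∀ u → ∣ X u ∣ ≡ 0 ⊎ ∣ X u ∣ ≡ 2
    degree u with covered? u
    ... | no none = inj₁ (∣empty∣≡0 λ x∈ → let (i , σ , _ , u∈) = ∈X⁻ x∈ in none (i , σ , u∈))
    ... | yes (i , σ , u∈) with covers i σ u∈
    ...   | inj₁ refl        = inj₂ (end-degree i σ)
    ...   | inj₂ (inj₁ refl) = inj₂ (slot-degree i (end σ))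
    ...   | inj₂ (inj₂ refl) = inj₂ (top-degree i)

-- Lower bound for the number of darts

module Counting {n m : ℕ} (H : Hypergraph3 n m) (linear : Linear H) where
  open Darts H linear
  open IsFlag
  open IsDart

  U M : ℕ
  U = length flags
  M = length darts

  flag-of : ∀ i → ∃[ φ ] (IsFlag φ × hy φ ≡ i)
  flag-of i with elements (edge H i) | length-elements (edge H i) | elements-∈ (edge H i) | elements-! (edge H i)
  ... | []                 | eq | _ | _ = contradiction (trans eq (uniform H i)) λ ()
  ... | _ ∷ []             | eq | _ | _ = contradiction (trans eq (uniform H i)) λ ()
  ... | _ ∷ _ ∷ []         | eq | _ | _ = contradiction (trans eq (uniform H i)) λ ()
  ... | _ ∷ _ ∷ _ ∷ _ ∷ _  | eq | _ | _ = contradiction (trans eq (uniform H i)) λ ()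
  ... | a ∷ b ∷ z ∷ [] | _ | a∈ ∷ b∈ ∷ z∈ ∷ [] | (a≢b ∷ a≢z ∷ []) ∷ (b≢z ∷ []) ∷ _ =
    (i , a , b , z) , isFlag a∈ b∈ z∈ a≢b a≢z b≢z , refl

  m≤U : m ≤ U
  m≤U = begin
    m
      ≡⟨ trans (sym (length-allFin m)) (∑-length (allFin m)) ⟩
    (∑[ i ← allFin m ] 1)
      ≤⟨ ∑-mono (allFin m) (λ {i} _ → let (φ , F , eq) = flag-of i in
           ≤-trans (≤-reflexive (sym (⟦⟧-yes (hy φ Fin.≟ i) eq))) (∑-∈ (λ φ → ⟦ hy φ Fin.≟ i ⟧) (∈-flags⁺ F))) ⟩
    (∑[ i ← allFin m ] ∑[ φ ← flags ] ⟦ hy φ Fin.≟ i ⟧)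
      ≡⟨ ∑-swap (allFin m) flags _ ⟩
    (∑[ φ ← flags ] ∑[ i ← allFin m ] ⟦ hy φ Fin.≟ i ⟧)
      ≡⟨ ∑-cong flags (λ φ → trans (∑-cong (allFin m) (λ i → sym (*-identityʳ _)))
           (∑-single Fin._≟_ (allFin⁺ m) (∈-allFin (hy φ)) (λ _ → 1))) ⟩
    (∑[ φ ← flags ] 1)
      ≡⟨ sym (∑-length flags) ⟩
    U ∎
    where open ≤-Reasoning

  pairs : ℕ
  pairs = ∑[ φ ← flags ] ∑[ ψ ← flags ] ⟦ apex φ Fin.≟ apex ψ ⟧

  -- Cauchy-Schwarz over the n possible apexes of a flag.
  U²≤n*pairs : U * U ≤ n * pairs
  U²≤n*pairs = begin
    U * U
      ≡⟨ cong₂ _*_ U≡ U≡ ⟩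
    (∑[ z ← allFin n ] deg z) * (∑[ z ← allFin n ] deg z)
      ≤⟨ cauchy-1 (allFin n) deg ⟩
    length (allFin n) * (∑[ z ← allFin n ] deg z * deg z)
      ≡⟨ cong₂ _*_ (length-allFin n) squares ⟩
    n * pairs ∎
    where
    open ≤-Reasoning
    deg : Fin n → ℕ
    deg z = ∑[ φ ← flags ] ⟦ apex φ Fin.≟ z ⟧
    single : ∀ φ (F : Fin n → ℕ) → (∑[ z ← allFin n ] ⟦ apex φ Fin.≟ z ⟧ * F z) ≡ F (apex φ)
    single φ F = ∑-single Fin._≟_ (allFin⁺ n) (∈-allFin (apex φ)) F
    U≡ : U ≡ (∑[ z ← allFin n ] deg z)
    U≡ = trans (∑-length flags) (trans
      (∑-cong flags (λ φ → trans (sym (single φ (λ _ → 1))) (∑-cong (allFin n) (λ z → *-identityʳ _))))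
      (∑-swap flags (allFin n) _))
    squares : (∑[ z ← allFin n ] deg z * deg z) ≡ pairs
    squares = begin-equality
      (∑[ z ← allFin n ] deg z * deg z)
        ≡⟨ ∑-cong (allFin n) (λ z → ∑-* flags flags _ _) ⟩
      (∑[ z ← allFin n ] ∑[ φ ← flags ] ∑[ ψ ← flags ] ⟦ apex φ Fin.≟ z ⟧ * ⟦ apex ψ Fin.≟ z ⟧)
        ≡⟨ trans (∑-swap (allFin n) flags _) (∑-cong flags (λ φ → ∑-swap (allFin n) flags _)) ⟩
      (∑[ φ ← flags ] ∑[ ψ ← flags ] ∑[ z ← allFin n ] ⟦ apex φ Fin.≟ z ⟧ * ⟦ apex ψ Fin.≟ z ⟧)
        ≡⟨ ∑-cong flags (λ φ → ∑-cong flags (λ ψ → trans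
             (single φ (λ z → ⟦ apex ψ Fin.≟ z ⟧))
             (⟦⟧-cong (apex ψ Fin.≟ apex φ) (apex φ Fin.≟ apex ψ) sym sym))) ⟩
      pairs ∎

  same-edge : ∀ {φ ψ} → IsFlag φ → IsFlag ψ → apex φ ≡ apex ψ → hy φ ≡ hy ψ → φ ≡ ψ ⊎ swap φ ≡ ψ
  same-edge {φ} {ψ} F G refl refl with flag-covers F (tail∈ G)
  ... | inj₁ p        = inj₁ (tail-apex-determine F G (sym p) refl)
  ... | inj₂ (inj₁ p) = inj₂ (tail-apex-determine (swap-isFlag F) G (sym p) refl)
  ... | inj₂ (inj₂ p) = contradiction p (tail≢apex G)

  -- A pair of flags with common apex that is not a dart lies in one edge, which leaves only `φ`
  -- itself and `swap φ` as partners of `φ`.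
  pairs≤ : pairs ≤ M + (U + U)
  pairs≤ = begin
    (∑[ φ ← flags ] ∑[ ψ ← flags ] ⟦ apex φ Fin.≟ apex ψ ⟧)
      ≤⟨ ∑-mono flags (λ {φ} φ∈ → ∑-mono flags (λ {ψ} ψ∈ → pointwise φ ψ (∈-flags⁻ φ∈) (∈-flags⁻ ψ∈))) ⟩
    (∑[ φ ← flags ] ∑[ ψ ← flags ] (C φ ψ + (⟦ φ ≟ᶠ ψ ⟧ * 1 + ⟦ swap φ ≟ᶠ ψ ⟧ * 1)))
      ≡⟨ ∑-cong-∈ flags (λ {φ} φ∈ → trans (∑-+ flags _ _) (cong (∑ flags (C φ) +_) (trans (∑-+ flags _ _)
           (cong₂ _+_ (∑-single _≟ᶠ_ flags! φ∈ (λ _ → 1))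
                      (∑-single _≟ᶠ_ flags! (∈-flags⁺ (swap-isFlag (∈-flags⁻ φ∈))) (λ _ → 1)))))) ⟩
    (∑[ φ ← flags ] (∑ flags (C φ) + 2))
      ≡⟨ ∑-+ flags _ _ ⟩
    (∑[ φ ← flags ] ∑ flags (C φ)) + (∑[ φ ← flags ] 2)
      ≡⟨ cong₂ _+_ (sym M≡) (trans (∑-const flags 2)
           (solve 1 (λ u → u :* con 2 := u :+ u) refl U)) ⟩
    M + (U + U) ∎
    where
    open ≤-Reasoning
    C : Flag → Flag → ℕ
    C φ ψ = ⟦ compatible? (φ , ψ) ⟧
    M≡ : M ≡ (∑[ φ ← flags ] ∑[ ψ ← flags ] C φ ψ)
    M≡ = trans (∑-length darts) (trans (∑-filter compatible? (cartesianProduct flags flags) (λ _ → 1))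
      (trans (∑-cartesianProduct flags flags _)
        (∑-cong flags (λ φ → ∑-cong flags (λ ψ → *-identityʳ _)))))
    pointwise : ∀ φ ψ → IsFlag φ → IsFlag ψ →
                ⟦ apex φ Fin.≟ apex ψ ⟧ ≤ C φ ψ + (⟦ φ ≟ᶠ ψ ⟧ * 1 + ⟦ swap φ ≟ᶠ ψ ⟧ * 1)
    pointwise φ ψ F G = ⟦⟧-≤ (apex φ Fin.≟ apex ψ) bound
      where
      ≥1 : ∀ {P : Set} (d : Dec P) → P → 1 ≤ ⟦ d ⟧ * 1
      ≥1 d p = ≤-reflexive (sym (cong (_* 1) (⟦⟧-yes d p)))
      bound : apex φ ≡ apex ψ → 1 ≤ C φ ψ + (⟦ φ ≟ᶠ ψ ⟧ * 1 + ⟦ swap φ ≟ᶠ ψ ⟧ * 1)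
      bound z≡ = by-edge (hy φ Fin.≟ hy ψ)
        where
        by-edge : Dec (hy φ ≡ hy ψ) → 1 ≤ C φ ψ + (⟦ φ ≟ᶠ ψ ⟧ * 1 + ⟦ swap φ ≟ᶠ ψ ⟧ * 1)
        by-edge (no h≢)  = ≤-trans (≤-reflexive (sym (⟦⟧-yes (compatible? (φ , ψ)) (z≡ , h≢)))) (m≤m+n (C φ ψ) _)
        by-edge (yes h≡) = m≤n⇒m≤o+n (C φ ψ)
          ([ (λ p → ≤-trans (≥1 (φ ≟ᶠ ψ) p) (m≤m+n _ _))
           , (λ p → m≤n⇒m≤o+n (⟦ φ ≟ᶠ ψ ⟧ * 1) (≥1 (swap φ ≟ᶠ ψ) p)) ]′ (same-edge F G z≡ h≡))

  -- From U² ≤ n(M + 2U): once 4n ≤ U, the error term 2nU is at most half of U² and is absorbed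
  -- after doubling.
  few-or-many : m ≤ 4 * n ⊎ m * m ≤ 2 * n * M
  few-or-many with ≤-total U (4 * n)
  ... | inj₁ U≤4n = inj₁ (≤-trans m≤U U≤4n)
  ... | inj₂ 4n≤U = inj₂ (≤-trans (*-mono-≤ m≤U m≤U) (+-cancelʳ-≤ (U * U) _ _ (begin
    U * U + U * U              ≡⟨ cong (U * U +_) (sym (+-identityʳ _)) ⟩
    2 * (U * U)                ≤⟨ *-monoʳ-≤ 2 (≤-trans U²≤n*pairs (*-monoʳ-≤ n pairs≤)) ⟩
    2 * (n * (M + (U + U)))
      ≡⟨ solve 3 (λ n m u → con 2 :* (n :* (m :+ (u :+ u))) := con 2 :* n :* m :+ con 4 :* n :* u) refl n M U ⟩
    2 * n * M + 4 * n * U      ≤⟨ +-monoʳ-≤ (2 * n * M) (*-monoˡ-≤ U 4n≤U) ⟩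
    2 * n * M + U * U ∎)))
    where open ≤-Reasoning

-- The walk bound applied to the split graph of darts

module DartBound {n m : ℕ} (H : Hypergraph3 n m) (linear : Linear H) (ℓ : ℕ) (no2reg : No2RegUpTo (4 * ℓ) H)
                 (δ : ℕ) .{{_ : NonZero δ}} where
  open Darts H linear
  open Cycle H linear

  n² : List (Fin n × Fin n)
  n² = cartesianProduct (allFin n) (allFin n)

  open Splitting _≟ᵈ_ (≡-dec Fin._≟_ Fin._≟_) src
  open Classes darts darts! n² (cartesianProduct⁺ (allFin⁺ n) (allFin⁺ n))
         (λ _ → ∈-cartesianProduct⁺ (∈-allFin _) (∈-allFin _)) δ public

  -- The target of a dart is taken to be the class of its reverse, so `rev` interchanges both ends;
  -- for the same reason the in-degrees inherit the bound of `fibre-size`.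
  reversible : ∀ x y → (∑[ e ← darts ] ⟦ cls e ≟ x ⟧ * ⟦ cls (rev e) ≟ y ⟧) ≡
                       (∑[ e ← darts ] ⟦ cls e ≟ y ⟧ * ⟦ cls (rev e) ≟ x ⟧)
  reversible x y = trans (sym (∑-rev (λ e → ⟦ cls e ≟ x ⟧ * ⟦ cls (rev e) ≟ y ⟧)))
    (∑-cong darts (λ e → *-comm ⟦ cls (rev e) ≟ x ⟧ ⟦ cls e ≟ y ⟧))

  cls-refines : ∀ {e f} → cls e ≡ cls f → src e ≡ src f
  cls-refines = cong proj₁

  open Walks darts 𝕍 _≟_ cls (λ e → cls (rev e)) ∑-δ reversible
  open Conflicts χ χ-sym 9 δ χ≤9 (λ x {f} _ → few-conflicts _≟_ cls cls-refines x f)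
    (λ x → ≤-trans (≤-reflexive (∑-rev (λ e → ⟦ cls e ≟ x ⟧))) (fibre-size x))

  no-conflict-free : ∀ k v → k < ℓ → length v ≡ suc k + suc k → All (_∈ darts) v → 1 ≤ cl v → ConflictFree v → ⊥
  no-conflict-free k (e ∷ v) k<ℓ len v∈ closed free =
    no2reg (edges-of (e ∷ v))
      -- A closed walk through classes projects to a closed walk through pairs of vertices.
      (cycle⇒TwoRegularSub e v v∈ free (λ i → cls-refines (closed-links e v closed i)))
      (begin
        ∣ edges-of (e ∷ v) ∣    ≤⟨ ∣edges-of∣≤ (e ∷ v) ⟩
        2 * length (e ∷ v)      ≡⟨ cong (2 *_) len ⟩
        2 * (suc k + suc k)
          ≡⟨ solve 1 (λ k → con 2 :* (k :+ k) := con 4 :* k) refl (suc k) ⟩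
        4 * suc k               ≤⟨ *-monoʳ-≤ 4 k<ℓ ⟩
        4 * ℓ ∎)
    where open ≤-Reasoning

  constant : ℕ
  constant = bound ℓ

  dart-bound : length 𝕍 * (length darts * length darts) ^ ℓ ≤
               length 𝕍 * ((constant * δ) ^ ℓ * length 𝕍) * (length 𝕍 * length 𝕍) ^ ℓ
  dart-bound = edge-bound ℓ no-conflict-free

-- Solving the inequalities for the number of edges

^-distribʳ-* : ∀ a b k → (a * b) ^ k ≡ a ^ k * b ^ k
^-distribʳ-* a b zero    = refl
^-distribʳ-* a b (suc k) = trans (cong (a * b *_) (^-distribʳ-* a b k))
  (solve 4 (λ a b x y → a :* b :* (x :* y) := a :* x :* (b :* y)) refl a b (a ^ k) (b ^ k))

-- The splitting threshold δ is chosen with δ n² ≈ M, which makes the number N of classes at most 2 n².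
solve-for-darts : ∀ ℓ B M N s .{{_ : NonZero B}} .{{_ : NonZero s}} → let δ = suc (M / s) in
  s ≤ N → N * δ ≤ s * δ + M →
  N * (M * M) ^ ℓ ≤ N * ((B * δ) ^ ℓ * N) * (N * N) ^ ℓ →
  M ^ ℓ ≤ 2 * (8 * B) ^ ℓ * (s * s ^ ℓ)
solve-for-darts ℓ B M N s s≤N Nδ≤ main with ≤-total M s
... | inj₁ M≤s = begin
  M ^ ℓ                             ≤⟨ ^-monoˡ-≤ ℓ M≤s ⟩
  s ^ ℓ                             ≤⟨ m≤n*m (s ^ ℓ) s ⟩
  s * s ^ ℓ                         ≤⟨ m≤n*m (s * s ^ ℓ) (2 * (8 * B) ^ ℓ) {{nz}} ⟩
  2 * (8 * B) ^ ℓ * (s * s ^ ℓ) ∎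
  where
  open ≤-Reasoning
  nz : NonZero (2 * (8 * B) ^ ℓ)
  nz = m*n≢0 2 ((8 * B) ^ ℓ) {{_}} {{m^n≢0 (8 * B) ℓ {{m*n≢0 8 B}}}}
-- Multiplying `main` by `s ^ ℓ` turns δ into `δ * s`, which is at most `2 * M` because `s ≤ M`
-- here; the resulting factor `(M * s) ^ ℓ` cancels.
... | inj₂ s≤M = *-cancelˡ-≤ ((M * s) ^ ℓ) {{m^n≢0 (M * s) ℓ {{m*n≢0 M s {{M≢0}}}}}} (begin
  (M * s) ^ ℓ * M ^ ℓ
    ≡⟨ sym (^-distribʳ-* (M * s) M ℓ) ⟩
  (M * s * M) ^ ℓ
    ≡⟨ cong (_^ ℓ) (solve 2 (λ m s → m :* s :* m := m :* m :* s) refl M s) ⟩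
  (M * M * s) ^ ℓ
    ≡⟨ ^-distribʳ-* (M * M) s ℓ ⟩
  (M * M) ^ ℓ * s ^ ℓ
    ≤⟨ *-monoˡ-≤ (s ^ ℓ) (*-cancelˡ-≤ N {{N≢0}} (≤-trans main (≤-reflexive (*-assoc N _ _)))) ⟩
  (B * δ) ^ ℓ * N * (N * N) ^ ℓ * s ^ ℓ
    ≤⟨ *-monoˡ-≤ (s ^ ℓ) (*-mono-≤ (*-monoʳ-≤ ((B * δ) ^ ℓ) N≤2s) (^-monoˡ-≤ ℓ (*-mono-≤ N≤2s N≤2s))) ⟩
  (B * δ) ^ ℓ * (2 * s) * (2 * s * (2 * s)) ^ ℓ * s ^ ℓ
    ≡⟨ solve 4 (λ x t y z → x :* t :* y :* z := t :* (x :* (y :* z))) refl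
         ((B * δ) ^ ℓ) (2 * s) ((2 * s * (2 * s)) ^ ℓ) (s ^ ℓ) ⟩
  2 * s * ((B * δ) ^ ℓ * ((2 * s * (2 * s)) ^ ℓ * s ^ ℓ))
    ≡⟨ cong (2 * s *_) (trans (cong ((B * δ) ^ ℓ *_) (sym (^-distribʳ-* (2 * s * (2 * s)) s ℓ)))
         (sym (^-distribʳ-* (B * δ) (2 * s * (2 * s) * s) ℓ))) ⟩
  2 * s * (B * δ * (2 * s * (2 * s) * s)) ^ ℓ
    ≡⟨ cong (λ z → 2 * s * z ^ ℓ) (solve 3 (λ b d s →
         b :* d :* (con 2 :* s :* (con 2 :* s) :* s) := d :* s :* (con 4 :* b :* (s :* s))) refl B δ s) ⟩
  2 * s * (δ * s * (4 * B * (s * s))) ^ ℓ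
    ≤⟨ *-monoʳ-≤ (2 * s) (^-monoˡ-≤ ℓ (*-monoˡ-≤ (4 * B * (s * s)) δs≤)) ⟩
  2 * s * (2 * M * (4 * B * (s * s))) ^ ℓ
    ≡⟨ cong (λ z → 2 * s * z ^ ℓ) (solve 3 (λ b m s →
         con 2 :* m :* (con 4 :* b :* (s :* s)) := m :* s :* (con 8 :* b :* s)) refl B M s) ⟩
  2 * s * (M * s * (8 * B * s)) ^ ℓ
    ≡⟨ cong (2 * s *_) (trans (^-distribʳ-* (M * s) (8 * B * s) ℓ)
         (cong ((M * s) ^ ℓ *_) (^-distribʳ-* (8 * B) s ℓ))) ⟩
  2 * s * ((M * s) ^ ℓ * ((8 * B) ^ ℓ * s ^ ℓ))
    ≡⟨ solve 4 (λ s x y z → con 2 :* s :* (x :* (y :* z)) := x :* (con 2 :* y :* (s :* z))) refl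
         s ((M * s) ^ ℓ) ((8 * B) ^ ℓ) (s ^ ℓ) ⟩
  (M * s) ^ ℓ * (2 * (8 * B) ^ ℓ * (s * s ^ ℓ)) ∎)
  where
  open ≤-Reasoning
  δ : ℕ
  δ = suc (M / s)
  M≢0 : NonZero M
  M≢0 = >-nonZero (≤-trans (>-nonZero⁻¹ s) s≤M)
  N≢0 : NonZero N
  N≢0 = >-nonZero (≤-trans (>-nonZero⁻¹ s) s≤N)
  δs≤ : δ * s ≤ 2 * M
  δs≤ = +-mono-≤ s≤M (≤-trans (m/n*n≤m M s) (≤-reflexive (sym (+-identityʳ M))))
  M≤ : M ≤ s * δ
  M≤ = ≤-trans (≤-reflexive (m≡m%n+[m/n]*n M s))
         (≤-trans (+-monoˡ-≤ _ (<⇒≤ (m%n<n M s))) (≤-reflexive (*-comm δ s)))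
  N≤2s : N ≤ 2 * s
  N≤2s = *-cancelʳ-≤ N (2 * s) δ (≤-trans Nδ≤ (≤-trans (+-monoʳ-≤ (s * δ) M≤)
    (≤-reflexive (solve 2 (λ s d → s :* d :+ s :* d := con 2 :* s :* d) refl s δ))))

-- The value of `bound ℓ` for conflict constant 9, written outside all modules to make its
-- independence of the hypergraph visible.
conflictConstant : ℕ → ℕ
conflictConstant ℓ = (q + q) * (q + q)
  where q = 2 * (suc ℓ * suc ℓ) * 9

darts-few : ∀ {n m} .{{_ : NonZero n}} (H : Hypergraph3 n m) (linear : Linear H) ℓ → No2RegUpTo (4 * ℓ) H →
  length (Darts.darts H linear) ^ ℓ ≤ 2 * (8 * conflictConstant ℓ) ^ ℓ * (n * n * (n * n) ^ ℓ)
darts-few {n} H linear ℓ no2reg = solve-for-darts ℓ (conflictConstant ℓ) (length darts) (length 𝕍) (n * n) {{_}} {{m*n≢0 n n}}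
  (subst (_≤ length 𝕍) length-n² length-ps≤length-𝕍)
  (subst (λ s → length 𝕍 * δ ≤ s * δ + length darts) length-n² length-𝕍≤)
  dart-bound
  where
  open Darts H linear
  δ : ℕ
  δ = suc (_/_ (length darts) (n * n) {{m*n≢0 n n}})
  open DartBound H linear ℓ no2reg δ
  length-n² : length n² ≡ n * n
  length-n² = trans (∑-length n²) (trans (∑-cartesianProduct (allFin n) (allFin n) (λ _ → 1))
    (trans (∑-cong (allFin n) (λ _ → trans (sym (∑-length (allFin n))) (length-allFin n)))
      (trans (∑-const (allFin n) n) (cong (_* n) (length-allFin n)))))

n^[3ℓ+2] : ∀ n ℓ → n ^ ℓ * (n * n * (n * n) ^ ℓ) ≡ n ^ (3 * ℓ + 2)
n^[3ℓ+2] n ℓ = begin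
  n ^ ℓ * (n * n * (n * n) ^ ℓ)      ≡⟨ cong (λ z → n ^ ℓ * (n * n * z)) (^-distribʳ-* n n ℓ) ⟩
  n ^ ℓ * (n * n * (n ^ ℓ * n ^ ℓ))
    ≡⟨ solve 2 (λ n x → x :* (n :* n :* (x :* x)) := x :* (x :* (x :* con 1)) :* (n :* (n :* con 1))) refl n (n ^ ℓ) ⟩
  (n ^ ℓ) ^ 3 * n ^ 2                ≡⟨ cong (_* n ^ 2) (trans (^-*-assoc n ℓ 3) (cong (n ^_) (*-comm ℓ 3))) ⟩
  n ^ (3 * ℓ) * n ^ 2                ≡⟨ sym (^-distribˡ-+-* n (3 * ℓ) 2) ⟩
  n ^ (3 * ℓ + 2) ∎
  where open ≡-Reasoning

-- The two summands of the constant belong to the two cases of `few-or-many`: 16 comes from (4n)²,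
-- and 2 from m² ≤ 2nM.
edges-few : ∀ ℓ {n m} .{{_ : NonZero n}} (H : Hypergraph3 n m) → Linear H → No2RegUpTo (4 * ℓ) H →
  (m * m) ^ ℓ ≤ (16 ^ ℓ + 2 ^ ℓ * (2 * (8 * conflictConstant ℓ) ^ ℓ)) * n ^ (3 * ℓ + 2)
edges-few ℓ {n} {m} H linear no2reg with Counting.few-or-many H linear
... | inj₁ m≤4n = begin
  (m * m) ^ ℓ                        ≤⟨ ^-monoˡ-≤ ℓ (*-mono-≤ m≤4n m≤4n) ⟩
  (4 * n * (4 * n)) ^ ℓ
    ≡⟨ cong (_^ ℓ) (solve 1 (λ n → con 4 :* n :* (con 4 :* n) := con 16 :* (n :* n)) refl n) ⟩
  (16 * (n * n)) ^ ℓ                 ≡⟨ ^-distribʳ-* 16 (n * n) ℓ ⟩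
  16 ^ ℓ * (n * n) ^ ℓ               ≤⟨ *-monoʳ-≤ (16 ^ ℓ) (≤-trans (m≤n*m ((n * n) ^ ℓ) (n * n) {{m*n≢0 n n}})
                                          (m≤n*m (n * n * (n * n) ^ ℓ) (n ^ ℓ) {{m^n≢0 n ℓ}})) ⟩
  16 ^ ℓ * (n ^ ℓ * (n * n * (n * n) ^ ℓ)) ≡⟨ cong (16 ^ ℓ *_) (n^[3ℓ+2] n ℓ) ⟩
  16 ^ ℓ * n ^ (3 * ℓ + 2)           ≤⟨ *-monoˡ-≤ (n ^ (3 * ℓ + 2)) (m≤m+n (16 ^ ℓ) _) ⟩
  (16 ^ ℓ + 2 ^ ℓ * (2 * (8 * conflictConstant ℓ) ^ ℓ)) * n ^ (3 * ℓ + 2) ∎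
  where open ≤-Reasoning
... | inj₂ m²≤ = begin
  (m * m) ^ ℓ                        ≤⟨ ^-monoˡ-≤ ℓ m²≤ ⟩
  (2 * n * M) ^ ℓ                    ≡⟨ trans (^-distribʳ-* (2 * n) M ℓ) (cong (_* M ^ ℓ) (^-distribʳ-* 2 n ℓ)) ⟩
  2 ^ ℓ * n ^ ℓ * M ^ ℓ              ≤⟨ *-monoʳ-≤ (2 ^ ℓ * n ^ ℓ) (darts-few H linear ℓ no2reg) ⟩
  2 ^ ℓ * n ^ ℓ * (C * (n * n * (n * n) ^ ℓ))
    ≡⟨ solve 4 (λ t x c y → t :* x :* (c :* y) := t :* c :* (x :* y)) refl (2 ^ ℓ) (n ^ ℓ) C (n * n * (n * n) ^ ℓ) ⟩
  2 ^ ℓ * C * (n ^ ℓ * (n * n * (n * n) ^ ℓ)) ≡⟨ cong (2 ^ ℓ * C *_) (n^[3ℓ+2] n ℓ) ⟩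
  2 ^ ℓ * C * n ^ (3 * ℓ + 2)        ≤⟨ *-monoˡ-≤ (n ^ (3 * ℓ + 2)) (m≤n+m (2 ^ ℓ * C) (16 ^ ℓ)) ⟩
  (16 ^ ℓ + 2 ^ ℓ * C) * n ^ (3 * ℓ + 2) ∎
  where
  open ≤-Reasoning
  M C : ℕ
  M = length (Darts.darts H linear)
  C = 2 * (8 * conflictConstant ℓ) ^ ℓ

-- Both sides of the bound are raised to the power 2ℓ, which makes the exponent (3/2 + 1/ℓ) · 2ℓ =
-- 3ℓ + 2 integral; `c` is the corresponding power of the constant.
theorem1p2 : ∀ (ℓ : ℕ) → 2 ≤ ℓ → ∃[ c ] (∀ (n m : ℕ) (H : Hypergraph3 n m) → Linear H → No2RegUpTo (4 * ℓ) H → m ^ (2 * ℓ) ≤ c * n ^ (3 * ℓ + 2))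
theorem1p2 ℓ@(suc _) _ = c , bounded
  where
  c : ℕ
  c = 16 ^ ℓ + 2 ^ ℓ * (2 * (8 * conflictConstant ℓ) ^ ℓ)
  no-edge : (p : Subset 0) → ∣ p ∣ ≢ 3
  no-edge [] ()
  bounded : ∀ n m (H : Hypergraph3 n m) → Linear H → No2RegUpTo (4 * ℓ) H → m ^ (2 * ℓ) ≤ c * n ^ (3 * ℓ + 2)
  -- As ℓ is a successor, `0 ^ (2 * ℓ)` computes to 0; for n = 0 an edge could not have three
  -- vertices.
  bounded n         zero    H linear no2reg = z≤n
  bounded zero      (suc m) H linear no2reg = contradiction (uniform H zero) (no-edge (edge H zero))
  bounded n@(suc _) m       H linear no2reg = subst (_≤ c * n ^ (3 * ℓ + 2))
    (trans (cong (λ z → (m * z) ^ ℓ) (sym (*-identityʳ m))) (^-*-assoc m 2 ℓ)) (edges-few ℓ H linear no2reg)
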